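{- Consider the following equations in the unary symbol $'$, the binary symbols $\wedge,\vee$ and (where they occur) the constants $\mathsf T,\mathsf F,\mathsf U$: (1.1a) $x''=x$; (1.1b) $(x\wedge y)'=x'\vee y'$; (1.1d) $x\wedge(y\vee z)=(x\wedge y)\vee(x\wedge z)$; (1.1f) $x\vee(x\wedge y)=x$; (1.1g) $(x\wedge y)\vee(y\wedge x)=(y\wedge x)\vee(x\wedge y)$; (Mem1) $(x\vee y)\wedge z=(x\wedge z)\vee(x'\wedge(y\wedge z))$; (Mem2) $(x\vee y)\wedge z=(x\wedge z)\vee((x'\wedge y)\wedge z)$; (1.4a) $\mathsf U'=\mathsf U$; (1.4b) $\mathsf T\wedge x=x$; (1.4c) $\mathsf T'=\mathsf F$. Then: (i) $\mathrm{CL}$ (no distinguished constants) is completely axiomatised by the five axioms (1.1a), (1.1b), (Mem1), (1.1f), (1.1g), and this group of axioms is independent. (ii) $\mathrm{CL}$ is completely axiomatised by the six axioms (1.1a), (1.1b), (1.1d), (Mem2), (1.1f), (1.1g), and this group of axioms is independent. (iii) $\mathrm{CL}_2$ (only $\mathsf T$ and $\mathsf F$ distinguished) is completely axiomatised by (1.4b), (1.4c) and those in (i), and also by (1.4b), (1.4c) and those in (ii). Each of these groups of axioms is independent. (iv) $\mathrm{CL}^{\mathsf U}$ (only $\mathsf U$ distinguished) is completely axiomatised by (1.4a) and those in (i), and also by (1.4a) and those in (ii). Each of these groups of axioms is independent. (v) $\mathrm{CL}_3$ ($\mathsf T,\mathsf F,\mathsf U$ distinguished) is completely axiomatised by (1.4a),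 (1.4b), (1.4c) and those in (i), and also by (1.4a), (1.4b), (1.4c) and those in (ii). Each of these groups of axioms is independent.
   Context: $\mathrm{CL}$ (conditional logic of Guzmán and Squier) is the equational theory over the signature $\{{}',\wedge,\vee\}$ axiomatised by $x''=x$; $(x\wedge y)'=x'\vee y'$; $(x\wedge y)\wedge z=x\wedge(y\wedge z)$; $x\wedge(y\vee z)=(x\wedge y)\vee(x\wedge z)$; $(x\vee y)\wedge z=(x\wedge z)\vee(x'\wedge y\wedge z)$ (bracketing immaterial by associativity); $x\vee(x\wedge y)=x$; $(x\wedge y)\vee(y\wedge x)=(y\wedge x)\vee(x\wedge y)$. $\mathrm{CL}_2$ is $\mathrm{CL}$ with constants $\mathsf T,\mathsf F$ and the extra axioms $\mathsf T\wedge x=x$, $\mathsf T'=\mathsf F$. $\mathrm{CL}^{\mathsf U}$ is $\mathrm{CL}$ with constant $\mathsf U$ and the extra axiom $\mathsf U'=\mathsf U$. $\mathrm{CL}_3$ is $\mathrm{CL}$ with constants $\mathsf T,\mathsf F,\mathsf U$ and the three extra axioms $\mathsf T\wedge x=x$, $\mathsf T'=\mathsf F$, $\mathsf U'=\mathsf U$. A set $E$ of equations completely axiomatises one of these logics if, over the corresponding signature, exactly the equations of that logic (i.e. the equational consequences of its axioms just listed) are derivable from $E$ in equational logic. (By a theorem of Guzmán and Squier these are exactly the equations valid in the algebra $C=\{\mathsf T,\mathsf F,\mathsf U\}$ with $\mathsf T'=\mathsf F$, $\mathsf F'=\mathsf T$, $\mathsf U'=\mathsf U$; $\mathsf T\wedge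 y=y$, $\mathsf F\wedge y=\mathsf F$, $\mathsf U\wedge y=\mathsf U$; $\mathsf T\vee y=\mathsf T$, $\mathsf F\vee y=y$, $\mathsf U\vee y=\mathsf U$, with the relevant constants distinguished.) A group of axioms is independent if no axiom in it is derivable (in equational logic) from the other axioms of the group. -}

module Defs where

open import Data.Empty using (⊥)
open import Data.Fin using (Fin)
open import Data.List using (List; []; _∷_; _++_; length; lookup; removeAt)
open import Data.List.Membership.Propositional using (_∈_)
open import Data.Nat using (ℕ)
open import Data.Product using (_×_)
open import Function.Bundles using (_⇔_)
open import Relation.Nullary using (¬_)

infix 9 _′
infix 8 _∧_ _∨_
infix 6 _≈_
infix 4 _⊢_

-- The signature is ′, ∧, ∨ together with a type K of constant symbols; variables are
-- indexed by ℕ.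

data Term (K : Set) : Set where
  var     : ℕ → Term K
  con     : K → Term K
  _′      : Term K → Term K
  _∧_ _∨_ : Term K → Term K → Term K

record Equation (K : Set) : Set where
  constructor _≈_
  field
    lhs rhs : Term K

open Equation public

Substitution : Set → Set
Substitution K = ℕ → Term K

_[_] : ∀ {K} → Term K → Substitution K → Term K
var i   [ σ ] = σ i
con c   [ σ ] = con c
(t ′)   [ σ ] = (t [ σ ]) ′
(s ∧ t) [ σ ] = (s [ σ ]) ∧ (t [ σ ])
(s ∨ t) [ σ ] = (s [ σ ]) ∨ (t [ σ ])

data _⊢_ {K : Set} (E : List (Equation K)) : Equation K → Set where
  axiom        : ∀ {e} → e ∈ E → E ⊢ e
  reflexive    : ∀ {t} → E ⊢ t ≈ t
  symmetric    : ∀ {s t} → E ⊢ s ≈ t → E ⊢ t ≈ s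
  transitive   : ∀ {s t u} → E ⊢ s ≈ t → E ⊢ t ≈ u → E ⊢ s ≈ u
  ′-congruence : ∀ {s t} → E ⊢ s ≈ t → E ⊢ s ′ ≈ t ′
  ∧-congruence : ∀ {s s₁ t t₁} → E ⊢ s ≈ s₁ → E ⊢ t ≈ t₁ → E ⊢ s ∧ t ≈ s₁ ∧ t₁
  ∨-congruence : ∀ {s s₁ t t₁} → E ⊢ s ≈ s₁ → E ⊢ t ≈ t₁ → E ⊢ s ∨ t ≈ s₁ ∨ t₁
  substitution : ∀ {s t} (σ : Substitution K) → E ⊢ s ≈ t → E ⊢ s [ σ ] ≈ t [ σ ]

-- The second argument is the list of defining axioms of a logic, whose
-- equations are the consequences of that list.

CompletelyAxiomatises : ∀ {K} → List (Equation K) → List (Equation K) → Set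
CompletelyAxiomatises {K} E L = (e : Equation K) → E ⊢ e ⇔ L ⊢ e

Independent : ∀ {K} → List (Equation K) → Set
Independent E = (i : Fin (length E)) → ¬ (removeAt E i ⊢ lookup E i)

data TF : Set where
  𝖳 𝖥 : TF

data U : Set where
  𝖴 : U

data TFU : Set where
  𝖳 𝖥 𝖴 : TFU

module _ {K : Set} where

  private
    x y z : Term K
    x = var 0
    y = var 1
    z = var 2

  involution deMorgan ∧-associativity ∧-distributes-∨ : Equation K
  absorption weak-commutativity mem₁ mem₂ : Equation K

  involution = (x ′) ′ ≈ x
  deMorgan = (x ∧ y) ′ ≈ (x ′) ∨ (y ′)
  ∧-associativity = (x ∧ y) ∧ z ≈ x ∧ (y ∧ z)
  ∧-distributes-∨ = x ∧ (y ∨ z) ≈ (x ∧ y) ∨ (x ∧ z)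
  absorption = x ∨ (x ∧ y) ≈ x
  weak-commutativity = (x ∧ y) ∨ (y ∧ x) ≈ (y ∧ x) ∨ (x ∧ y)
  mem₁ = (x ∨ y) ∧ z ≈ (x ∧ z) ∨ ((x ′) ∧ (y ∧ z))
  mem₂ = (x ∨ y) ∧ z ≈ (x ∧ z) ∨ (((x ′) ∧ y) ∧ z)

  U-fixed : (u : K) → Equation K
  U-fixed u = (con u) ′ ≈ con u

  T-identity : (t : K) → Equation K
  T-identity t = con t ∧ x ≈ x

  T-negation : (t f : K) → Equation K
  T-negation t f = (con t) ′ ≈ con f

-- The fifth axiom is (x ∨ y) ∧ z = (x ∧ z) ∨ (x′ ∧ y ∧ z); as ∧ is associative
-- by the third, either bracketing gives the same consequences.

CLAxioms : (K : Set) → List (Equation K)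
CLAxioms K =
  involution ∷ deMorgan ∷ ∧-associativity ∷ ∧-distributes-∨ ∷ mem₁ ∷
  absorption ∷ weak-commutativity ∷ []

CL : List (Equation ⊥)
CL = CLAxioms ⊥

CL₂ : List (Equation TF)
CL₂ = CLAxioms TF ++ T-identity 𝖳 ∷ T-negation 𝖳 𝖥 ∷ []

CLᵁ : List (Equation U)
CLᵁ = CLAxioms U ++ U-fixed 𝖴 ∷ []

CL₃ : List (Equation TFU)
CL₃ = CLAxioms TFU ++ T-identity 𝖳 ∷ T-negation 𝖳 𝖥 ∷ U-fixed 𝖴 ∷ []

GroupI : (K : Set) → List (Equation K)
GroupI K = involution ∷ deMorgan ∷ mem₁ ∷ absorption ∷ weak-commutativity ∷ []

GroupII : (K : Set) → List (Equation K)
GroupII K =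
  involution ∷ deMorgan ∷ ∧-distributes-∨ ∷ mem₂ ∷ absorption ∷ weak-commutativity ∷ []

IndependentAxiomatisation : ∀ {K} → List (Equation K) → List (Equation K) → Set
IndependentAxiomatisation E L = CompletelyAxiomatises E L × Independent E

{-# OPTIONS --safe #-}
module Submission where

-- Both groups yield x ∧ (x′ ∨ y) = x ∧ y, (x ∧ y) ∧ x = x ∧ y and the left distributive
-- law.  Put v = x ∧ (y ∧ z) and w = (x ∧ y) ∧ z.  Then v = x ∧ w and w = w ∧ x, while
-- w = (x ∧ y) ∧ v.  Since x ∨ w = x and (x ∧ y) ∨ v = x ∧ y, the memory axiom makes w and v
-- absorb in both orders: v ∨ w = v and w ∨ v = w.  Weak commutativity of x and w gives
-- v ∨ w = w ∨ v, so ∧ is associative and the two memory axioms coincide.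
-- Independence is witnessed by finite algebras for CL₃; the other logics are reducts.

-- The obstacle is that brackets can be moved only below a repeated left factor. The easily reached
-- laws give `v = x ∧ w` and `w = w ∧ x`, so associativity amounts to `x ∧ w = w ∧ x`. Weak
-- commutativity only offers this inside a disjunction, which is why the absorptions between `v` and
-- `w` are needed. The law `x ∧ (x′ ∨ y) = x ∧ y` says that, once `x` has been evaluated to true,
-- `x′` no longer matters. With distributivity among the axioms it is soon reached. With `mem₁`
-- alone it takes a detour: `x ∧ x′`, whose value in C is F or U, is shown to be a left zero, and
-- `x ∨ x′` to be left neutral on terms beginning with `x` or `x′`. Involution and De Morgan make
-- every derived law available with `∧` and `∨` exchanged. The calculations use this duality
-- silently, so a cited law may appear in its dual form.

open import Data.Bool using (Bool; true; T; if_then_else_)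
import Data.Bool as Bool
open import Data.Bool.Properties using (T-∧)
open import Data.Empty using (⊥)
open import Data.Fin using (Fin; zero; suc; #_)
open import Data.Fin.Properties using (all?)
import Data.Fin.Properties as Fin
open import Data.List using (List; []; _∷_; _++_; length; lookup; removeAt; map)
open import Data.List.Membership.Propositional.Properties using (∈-map⁺)
open import Data.List.Relation.Binary.Sublist.Propositional
  using (_⊆_; _∷_; _∷ʳ_; ⊆-refl; ⊆-trans; to∈; from∈)
open import Data.List.Relation.Binary.Permutation.Propositional using (_↭_; ↭-refl; ↭-sym)
open import Data.List.Relation.Binary.Permutation.Propositional.Properties
  using (All-resp-↭; shift)
open import Data.List.Relation.Unary.All as All using (All; []; _∷_)
open import Data.List.Relation.Unary.All.Properties using (++⁺; ++⁻ˡ; ++⁻ʳ)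
open import Data.Maybe as Maybe using (Maybe; nothing; is-just; zipWith; _<∣>_; to-witness-T)
open import Data.Nat using (ℕ; _<ᵇ_; _≟_)
open import Data.Product using (_×_; _,_; ∃)
open import Data.Vec as Vec using (Vec; []; _∷_; replicate; allFin; tabulate)
open import Function using (_∘_)
open import Function.Bundles using (Equivalence; mk⇔)
open import Relation.Binary.PropositionalEquality
  using (_≡_; refl; sym; trans; cong; cong₂; subst)
open import Relation.Nullary using (¬_; Dec)
open import Relation.Nullary.Decidable
  using (True; toWitness; ¬?; _×-dec_; T?; dec⇒maybe; does)
open import Defs

open Equivalence using (to)

-- Equational rewriting up to negation normal form and duality.

module Calculation {K : Set} {E : List (Equation K)}
  (⊢involution : E ⊢ involution) (⊢deMorgan : E ⊢ deMorgan) where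

  x y z : Term K
  x = var 0
  y = var 1
  z = var 2

  _↦_ : ℕ → Term K → Substitution K → Substitution K
  (i ↦ t) σ j = if does (i ≟ j) then t else σ j

  ⊢x′′≈x : ∀ t → E ⊢ (t ′) ′ ≈ t
  ⊢x′′≈x t = substitution (λ _ → t) ⊢involution

  ⊢[s∧t]′ : ∀ s t → E ⊢ (s ∧ t) ′ ≈ (s ′) ∨ (t ′)
  ⊢[s∧t]′ s t = substitution ((0 ↦ s) ((1 ↦ t) var)) ⊢deMorgan

  ⊢[s∨t]′ : ∀ s t → E ⊢ (s ∨ t) ′ ≈ (s ′) ∧ (t ′)
  ⊢[s∨t]′ s t = transitive
    (′-congruence (transitive
      (∨-congruence (symmetric (⊢x′′≈x s)) (symmetric (⊢x′′≈x t)))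
      (symmetric (⊢[s∧t]′ (s ′) (t ′)))))
    (⊢x′′≈x _)

  nnf nnf′ : Term K → Term K
  nnf (var i) = var i
  nnf (con c) = con c
  nnf (t ′)   = nnf′ t
  nnf (s ∧ t) = nnf s ∧ nnf t
  nnf (s ∨ t) = nnf s ∨ nnf t
  nnf′ (var i) = var i ′
  nnf′ (con c) = con c ′
  nnf′ (t ′)   = nnf t
  nnf′ (s ∧ t) = nnf′ s ∨ nnf′ t
  nnf′ (s ∨ t) = nnf′ s ∧ nnf′ t

  ⊢nnf : ∀ t → E ⊢ t ≈ nnf t
  ⊢nnf′ : ∀ t → E ⊢ t ′ ≈ nnf′ t
  ⊢nnf (var i) = reflexive
  ⊢nnf (con c) = reflexive
  ⊢nnf (t ′)   = ⊢nnf′ t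
  ⊢nnf (s ∧ t) = ∧-congruence (⊢nnf s) (⊢nnf t)
  ⊢nnf (s ∨ t) = ∨-congruence (⊢nnf s) (⊢nnf t)
  ⊢nnf′ (var i) = reflexive
  ⊢nnf′ (con c) = reflexive
  ⊢nnf′ (t ′)   = transitive (⊢x′′≈x t) (⊢nnf t)
  ⊢nnf′ (s ∧ t) = transitive (⊢[s∧t]′ s t) (∨-congruence (⊢nnf′ s) (⊢nnf′ t))
  ⊢nnf′ (s ∨ t) = transitive (⊢[s∨t]′ s t) (∧-congruence (⊢nnf′ s) (⊢nnf′ t))

  -- `K` is arbitrary and has no decidable equality, so constants are never identified. The
  -- calculated laws contain variables only.
  same? : (s t : Term K) → Maybe (s ≡ t)
  same? (var i) (var j) = Maybe.map (cong var) (dec⇒maybe (i ≟ j))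
  same? (s ′) (t ′)         = Maybe.map (cong _′) (same? s t)
  same? (s ∧ t) (s₁ ∧ t₁) = zipWith (cong₂ _∧_) (same? s s₁) (same? t t₁)
  same? (s ∨ t) (s₁ ∨ t₁) = zipWith (cong₂ _∨_) (same? s s₁) (same? t t₁)
  same? _ _ = nothing

  -- Builds a candidate only: instance? checks it, so ill-fitting terms need no failure value.
  match : Term K → Term K → Substitution K → Substitution K
  match (var i)     t         σ = (i ↦ t) σ
  match (var i ′)   t         σ = (i ↦ nnf′ t) σ
  match (p ∧ q)     (s ∧ t)   σ = match p s (match q t σ)
  match (p ∨ q)     (s ∨ t)   σ = match p s (match q t σ)
  match _           _         σ = σ

  -- Both sides are matched, because a variable such as `y` in `absorption` occurs on one side only.
  -- Instances are normalised again, since a primed variable may receive a compound term.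
  instance? : ∀ {p q} → E ⊢ p ≈ q → ∀ s t → Maybe (E ⊢ s ≈ t)
  instance? {p} {q} p≈q s t =
    zipWith convert (same? (nnf (p [ σ ])) s) (same? (nnf (q [ σ ])) t)
    where
    σ = match (nnf p) s (match (nnf q) t var)

    convert : ∀ {s t} → nnf (p [ σ ]) ≡ s → nnf (q [ σ ]) ≡ t → E ⊢ s ≈ t
    convert refl refl = transitive (symmetric (⊢nnf (p [ σ ])))
      (transitive (substitution σ p≈q) (⊢nnf (q [ σ ])))

  -- Rewrites at any set of disjoint positions with p ≈ q read in either direction, itself or
  -- dualised (which is its primed form); s and t have to be in negation normal form.
  rewrite? : ∀ {p q} → E ⊢ p ≈ q → ∀ s t → Maybe (E ⊢ s ≈ t)
  rewrite? p≈q s t =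
        Maybe.map (λ { refl → reflexive }) (same? s t)
    <∣> instance? p≈q s t
    <∣> instance? (symmetric p≈q) s t
    <∣> instance? (′-congruence p≈q) s t
    <∣> instance? (′-congruence (symmetric p≈q)) s t
    <∣> inside s t
    where
    inside : ∀ s t → Maybe (E ⊢ s ≈ t)
    inside (s ∧ t) (s₁ ∧ t₁) =
      zipWith ∧-congruence (rewrite? p≈q s s₁) (rewrite? p≈q t t₁)
    inside (s ∨ t) (s₁ ∨ t₁) =
      zipWith ∨-congruence (rewrite? p≈q s s₁) (rewrite? p≈q t t₁)
    inside _ _ = nothing

  infix  3 _∎
  infixr 2 _≈⟨_⟩_

  _∎ : ∀ t → E ⊢ t ≈ t
  _ ∎ = reflexive

  -- The search runs during type checking: when it succeeds, the hidden argument has the unit type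
  -- and is filled in automatically.
  _≈⟨_⟩_ : ∀ {p q t u} s (p≈q : E ⊢ p ≈ q) → E ⊢ t ≈ u →
           {T (is-just (rewrite? p≈q s t))} → E ⊢ s ≈ u
  _≈⟨_⟩_ {t = t} s p≈q t≈u {found} =
    transitive (to-witness-T (rewrite? p≈q s t) found) t≈u

-- Associativity from the laws shared by both groups.

-- The name of a lemma is its equation, with ⟨ ⟩ for parentheses.

module Associativity {K : Set} {E : List (Equation K)}
  (⊢involution : E ⊢ involution) (⊢deMorgan : E ⊢ deMorgan)
  (⊢absorption : E ⊢ absorption) (⊢weak-commutativity : E ⊢ weak-commutativity)
  (⊢∧-distributes-∨ : E ⊢ ∧-distributes-∨)
  where

  open Calculation ⊢involution ⊢deMorgan

  -- `mem₂-diagonal` is `mem₂` with `z = y`. It is the form of the memory axiom in which the two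
  -- groups meet before associativity is known.
  module _
    (mem₂-diagonal : E ⊢ (x ∨ y) ∧ y ≈ (x ∧ y) ∨ ((x ′ ∧ y) ∧ y))
    (x∧x≈x : E ⊢ x ∧ x ≈ x)
    (x∧⟨x∧y⟩≈x∧y : E ⊢ x ∧ (x ∧ y) ≈ x ∧ y)
    (x∧⟨x′∨y⟩≈x∧y : E ⊢ x ∧ (x ′ ∨ y) ≈ x ∧ y)
    (⟨x∧y⟩∧x≈x∧y : E ⊢ (x ∧ y) ∧ x ≈ x ∧ y)
    (x∧⟨⟨x∧y⟩∧z⟩≈x∧⟨y∧z⟩ : E ⊢ x ∧ ((x ∧ y) ∧ z) ≈ x ∧ (y ∧ z))
    where

    ⟨x∧y⟩∧⟨x∧z⟩≈⟨x∧y⟩∧z : E ⊢ (x ∧ y) ∧ (x ∧ z) ≈ (x ∧ y) ∧ z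
    ⟨x∧y⟩∧⟨x∧z⟩≈⟨x∧y⟩∧z =
      (x ∧ y) ∧ (x ∧ z) ≈⟨ x∧⟨⟨x∧y⟩∧z⟩≈x∧⟨y∧z⟩ ⟩
      (x ∧ y) ∧ (((x ∧ y) ∧ x) ∧ z) ≈⟨ ⟨x∧y⟩∧x≈x∧y ⟩
      (x ∧ y) ∧ ((x ∧ y) ∧ z) ≈⟨ x∧⟨x∧y⟩≈x∧y ⟩
      (x ∧ y) ∧ z ∎

    ⟨x∧y⟩∧y≈x∧y : E ⊢ (x ∧ y) ∧ y ≈ x ∧ y
    ⟨x∧y⟩∧y≈x∧y =
      (x ∧ y) ∧ y ≈⟨ ⟨x∧y⟩∧⟨x∧z⟩≈⟨x∧y⟩∧z ⟩
      (x ∧ y) ∧ (x ∧ y) ≈⟨ x∧x≈x ⟩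
      x ∧ y ∎

    ⟨x∧y⟩∧⟨x∧⟨y∧z⟩⟩≈⟨x∧y⟩∧z : E ⊢ (x ∧ y) ∧ (x ∧ (y ∧ z)) ≈ (x ∧ y) ∧ z
    ⟨x∧y⟩∧⟨x∧⟨y∧z⟩⟩≈⟨x∧y⟩∧z =
      (x ∧ y) ∧ (x ∧ (y ∧ z)) ≈⟨ ⟨x∧y⟩∧⟨x∧z⟩≈⟨x∧y⟩∧z ⟩
      (x ∧ y) ∧ (y ∧ z) ≈⟨ x∧⟨⟨x∧y⟩∧z⟩≈x∧⟨y∧z⟩ ⟩
      (x ∧ y) ∧ (((x ∧ y) ∧ y) ∧ z) ≈⟨ ⟨x∧y⟩∧y≈x∧y ⟩
      (x ∧ y) ∧ ((x ∧ y) ∧ z) ≈⟨ x∧⟨x∧y⟩≈x∧y ⟩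
      (x ∧ y) ∧ z ∎

    ⟨⟨x∧y⟩∧z⟩∧x≈⟨x∧y⟩∧z : E ⊢ ((x ∧ y) ∧ z) ∧ x ≈ (x ∧ y) ∧ z
    ⟨⟨x∧y⟩∧z⟩∧x≈⟨x∧y⟩∧z =
      ((x ∧ y) ∧ z) ∧ x ≈⟨ ⟨x∧y⟩∧⟨x∧z⟩≈⟨x∧y⟩∧z ⟩
      ((x ∧ y) ∧ z) ∧ ((x ∧ y) ∧ x) ≈⟨ ⟨x∧y⟩∧x≈x∧y ⟩
      ((x ∧ y) ∧ z) ∧ (x ∧ y) ≈⟨ ⟨x∧y⟩∧x≈x∧y ⟩
      (x ∧ y) ∧ z ∎

    x∨⟨⟨x∧y⟩∧z⟩≈x : E ⊢ x ∨ ((x ∧ y) ∧ z) ≈ x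
    x∨⟨⟨x∧y⟩∧z⟩≈x =
      x ∨ ((x ∧ y) ∧ z) ≈⟨ ⊢∧-distributes-∨ ⟩
      (x ∨ (x ∧ y)) ∧ (x ∨ z) ≈⟨ ⊢absorption ⟩
      x ∧ (x ∨ z) ≈⟨ ⊢absorption ⟩
      x ∎

    ⟨x∧y⟩∨⟨x∧⟨y∧z⟩⟩≈x∧y : E ⊢ (x ∧ y) ∨ (x ∧ (y ∧ z)) ≈ x ∧ y
    ⟨x∧y⟩∨⟨x∧⟨y∧z⟩⟩≈x∧y =
      (x ∧ y) ∨ (x ∧ (y ∧ z)) ≈⟨ ⊢∧-distributes-∨ ⟩
      x ∧ (y ∨ (y ∧ z)) ≈⟨ ⊢absorption ⟩
      x ∧ y ∎

    ⟨x∧y⟩∨y≈⟨x∨y⟩∧⟨x′∨y⟩ : E ⊢ (x ∧ y) ∨ y ≈ (x ∨ y) ∧ (x ′ ∨ y)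
    ⟨x∧y⟩∨y≈⟨x∨y⟩∧⟨x′∨y⟩ =
      (x ∧ y) ∨ y ≈⟨ mem₂-diagonal ⟩
      (x ∨ y) ∧ ((x ′ ∨ y) ∨ y) ≈⟨ ⟨x∧y⟩∧y≈x∧y ⟩
      (x ∨ y) ∧ (x ′ ∨ y) ∎

    associative : E ⊢ ∧-associativity
    associative =
      (x ∧ y) ∧ z ≈⟨ ⟨x∧y⟩∧⟨x∧⟨y∧z⟩⟩≈⟨x∧y⟩∧z ⟩
      -- If `a ∨ b = a`, then `a ∧ b = a ∧ (a′ ∨ b) = (a ∨ b) ∧ (a′ ∨ b) = (a ∧ b) ∨ b`. Here `a = x
      -- ∧ y` and `b = v`, so `w = w ∨ v`.
      (x ∧ y) ∧ (x ∧ (y ∧ z)) ≈⟨ x∧⟨x′∨y⟩≈x∧y ⟩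
      (x ∧ y) ∧ ((x ′ ∨ y ′) ∨ (x ∧ (y ∧ z))) ≈⟨ ⟨x∧y⟩∨⟨x∧⟨y∧z⟩⟩≈x∧y ⟩
      ((x ∧ y) ∨ (x ∧ (y ∧ z))) ∧ ((x ′ ∨ y ′) ∨ (x ∧ (y ∧ z))) ≈⟨ ⟨x∧y⟩∨y≈⟨x∨y⟩∧⟨x′∨y⟩ ⟩
      ((x ∧ y) ∧ (x ∧ (y ∧ z))) ∨ (x ∧ (y ∧ z)) ≈⟨ ⟨x∧y⟩∧⟨x∧⟨y∧z⟩⟩≈⟨x∧y⟩∧z ⟩
      ((x ∧ y) ∧ z) ∨ (x ∧ (y ∧ z)) ≈⟨ x∧⟨⟨x∧y⟩∧z⟩≈x∧⟨y∧z⟩ ⟩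
      ((x ∧ y) ∧ z) ∨ (x ∧ ((x ∧ y) ∧ z)) ≈⟨ ⟨⟨x∧y⟩∧z⟩∧x≈⟨x∧y⟩∧z ⟩
      (((x ∧ y) ∧ z) ∧ x) ∨ (x ∧ ((x ∧ y) ∧ z)) ≈⟨ ⊢weak-commutativity ⟩
      (x ∧ ((x ∧ y) ∧ z)) ∨ (((x ∧ y) ∧ z) ∧ x) ≈⟨ ⟨⟨x∧y⟩∧z⟩∧x≈⟨x∧y⟩∧z ⟩
      -- The same argument backwards, with `a = x` and `b = w`: `v ∨ w` shrinks to `x ∧ w`.
      (x ∧ ((x ∧ y) ∧ z)) ∨ ((x ∧ y) ∧ z) ≈⟨ ⟨x∧y⟩∨y≈⟨x∨y⟩∧⟨x′∨y⟩ ⟩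
      (x ∨ ((x ∧ y) ∧ z)) ∧ (x ′ ∨ ((x ∧ y) ∧ z)) ≈⟨ x∨⟨⟨x∧y⟩∧z⟩≈x ⟩
      x ∧ (x ′ ∨ ((x ∧ y) ∧ z)) ≈⟨ x∧⟨x′∨y⟩≈x∧y ⟩
      x ∧ ((x ∧ y) ∧ z) ≈⟨ x∧⟨⟨x∧y⟩∧z⟩≈x∧⟨y∧z⟩ ⟩
      x ∧ (y ∧ z) ∎

-- Distributivity and associativity from the group with `mem₁`.

module GroupIConsequences {K : Set} {E : List (Equation K)}
  (⊢involution : E ⊢ involution) (⊢deMorgan : E ⊢ deMorgan) (⊢mem₁ : E ⊢ mem₁)
  (⊢absorption : E ⊢ absorption) (⊢weak-commutativity : E ⊢ weak-commutativity)
  where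

  open Calculation ⊢involution ⊢deMorgan

  x∧x≈x : E ⊢ x ∧ x ≈ x
  x∧x≈x =
    x ∧ x ≈⟨ ⊢absorption ⟩
    x ∧ (x ∨ (x ∧ y ′)) ≈⟨ ⊢absorption ⟩
    x ∎

  x∧⟨x′∨⟨y∨⟨x∧z⟩⟩⟩≈⟨x∧y⟩∨⟨x∧z⟩ : E ⊢ x ∧ (x ′ ∨ (y ∨ (x ∧ z))) ≈ (x ∧ y) ∨ (x ∧ z)
  x∧⟨x′∨⟨y∨⟨x∧z⟩⟩⟩≈⟨x∧y⟩∨⟨x∧z⟩ =
    x ∧ (x ′ ∨ (y ∨ (x ∧ z))) ≈⟨ ⊢absorption ⟩
    (x ∨ (x ∧ z)) ∧ (x ′ ∨ (y ∨ (x ∧ z))) ≈⟨ ⊢mem₁ ⟩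
    (x ∧ y) ∨ (x ∧ z) ∎

  x∧⟨x′∧y⟩≈x∧x′ : E ⊢ x ∧ (x ′ ∧ y) ≈ x ∧ x ′
  x∧⟨x′∧y⟩≈x∧x′ =
    x ∧ (x ′ ∧ y) ≈⟨ x∧x≈x ⟩
    -- Doubling by idempotence creates the right-hand side of the preceding law, with `x′ ∧ y` in
    -- place of both `y` and `z`.
    (x ∧ (x ′ ∧ y)) ∨ (x ∧ (x ′ ∧ y)) ≈⟨ x∧⟨x′∨⟨y∨⟨x∧z⟩⟩⟩≈⟨x∧y⟩∨⟨x∧z⟩ ⟩
    x ∧ (x ′ ∨ ((x ′ ∧ y) ∨ (x ∧ (x ′ ∧ y)))) ≈⟨ ⊢mem₁ ⟩
    x ∧ (x ′ ∨ ((x ′ ∨ x ′) ∧ y)) ≈⟨ x∧x≈x ⟩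
    x ∧ (x ′ ∨ (x ′ ∧ y)) ≈⟨ ⊢absorption ⟩
    x ∧ x ′ ∎

  ⟨x∨⟨y∧z⟩⟩∧⟨x′∨y⟩≈⟨x∧y⟩∨⟨y∧z⟩ : E ⊢ (x ∨ (y ∧ z)) ∧ (x ′ ∨ y) ≈ (x ∧ y) ∨ (y ∧ z)
  ⟨x∨⟨y∧z⟩⟩∧⟨x′∨y⟩≈⟨x∧y⟩∨⟨y∧z⟩ =
    (x ∨ (y ∧ z)) ∧ (x ′ ∨ y) ≈⟨ ⊢absorption ⟩
    (x ∨ (y ∧ z)) ∧ (x ′ ∨ (y ∨ (y ∧ z))) ≈⟨ ⊢mem₁ ⟩
    (x ∧ y) ∨ (y ∧ z) ∎

  x∧⟨x′∨⟨y∨x⟩⟩≈⟨x∧y⟩∨x : E ⊢ x ∧ (x ′ ∨ (y ∨ x)) ≈ (x ∧ y) ∨ x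
  x∧⟨x′∨⟨y∨x⟩⟩≈⟨x∧y⟩∨x =
    x ∧ (x ′ ∨ (y ∨ x)) ≈⟨ x∧x≈x ⟩
    (x ∨ x) ∧ (x ′ ∨ (y ∨ x)) ≈⟨ ⊢mem₁ ⟩
    (x ∧ y) ∨ x ∎

  x∧⟨x′∨x⟩≈x : E ⊢ x ∧ (x ′ ∨ x) ≈ x
  x∧⟨x′∨x⟩≈x =
    x ∧ (x ′ ∨ x) ≈⟨ x∧x≈x ⟩
    x ∧ (x ′ ∨ (x ∨ x)) ≈⟨ x∧⟨x′∨⟨y∨x⟩⟩≈⟨x∧y⟩∨x ⟩
    (x ∧ x) ∨ x ≈⟨ x∧x≈x ⟩
    x ∨ x ≈⟨ x∧x≈x ⟩
    x ∎

  ⟨x∨x′⟩∧⟨x′∨x⟩≈x∨x′ : E ⊢ (x ∨ x ′) ∧ (x ′ ∨ x) ≈ x ∨ x ′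
  ⟨x∨x′⟩∧⟨x′∨x⟩≈x∨x′ =
    (x ∨ x ′) ∧ (x ′ ∨ x) ≈⟨ ⟨x∨⟨y∧z⟩⟩∧⟨x′∨y⟩≈⟨x∧y⟩∨⟨y∧z⟩ ⟩
    (x ∧ (x ′ ∨ x)) ∨ (x ′ ∧ x ′) ≈⟨ x∧⟨x′∨x⟩≈x ⟩
    x ∨ (x ′ ∧ x ′) ≈⟨ x∧x≈x ⟩
    x ∨ x ′ ∎

  -- Weak commutativity for `x` and `x′`, where each of the two disjunctions collapses to its first
  -- member.
  x∧x′≈x′∧x : E ⊢ x ∧ x ′ ≈ x ′ ∧ x
  x∧x′≈x′∧x =
    x ∧ x ′ ≈⟨ ⟨x∨x′⟩∧⟨x′∨x⟩≈x∨x′ ⟩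
    (x ∧ x ′) ∨ (x ′ ∧ x) ≈⟨ ⊢weak-commutativity ⟩
    (x ′ ∧ x) ∨ (x ∧ x ′) ≈⟨ ⟨x∨x′⟩∧⟨x′∨x⟩≈x∨x′ ⟩
    x ′ ∧ x ∎

  ⟨x∨y⟩∧⟨x′∨x⟩≈x∨y : E ⊢ (x ∨ y) ∧ (x ′ ∨ x) ≈ x ∨ y
  ⟨x∨y⟩∧⟨x′∨x⟩≈x∨y =
    (x ∨ y) ∧ (x ′ ∨ x) ≈⟨ x∧⟨x′∧y⟩≈x∧x′ ⟩
    (x ∨ y) ∧ (x ′ ∨ (x ∨ y)) ≈⟨ ⊢mem₁ ⟩
    (x ∧ x) ∨ y ≈⟨ x∧x≈x ⟩
    x ∨ y ∎

  ⟨x∨y⟩∧⟨x∨x′⟩≈x∨y : E ⊢ (x ∨ y) ∧ (x ∨ x ′) ≈ x ∨ y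
  ⟨x∨y⟩∧⟨x∨x′⟩≈x∨y =
    (x ∨ y) ∧ (x ∨ x ′) ≈⟨ x∧x′≈x′∧x ⟩
    (x ∨ y) ∧ (x ′ ∨ x) ≈⟨ ⟨x∨y⟩∧⟨x′∨x⟩≈x∨y ⟩
    x ∨ y ∎

  x∧⟨x′∨⟨y∨⟨x∧x′⟩⟩⟩≈x∧y : E ⊢ x ∧ (x ′ ∨ (y ∨ (x ∧ x ′))) ≈ x ∧ y
  x∧⟨x′∨⟨y∨⟨x∧x′⟩⟩⟩≈x∧y =
    x ∧ (x ′ ∨ (y ∨ (x ∧ x ′))) ≈⟨ x∧⟨x′∨⟨y∨⟨x∧z⟩⟩⟩≈⟨x∧y⟩∨⟨x∧z⟩ ⟩
    (x ∧ y) ∨ (x ∧ x ′) ≈⟨ ⟨x∨y⟩∧⟨x∨x′⟩≈x∨y ⟩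
    x ∧ y ∎

  ⟨x∧y⟩∧⟨⟨x∨z⟩∧y⟩≈x∧y : E ⊢ (x ∧ y) ∧ ((x ∨ z) ∧ y) ≈ x ∧ y
  ⟨x∧y⟩∧⟨⟨x∨z⟩∧y⟩≈x∧y =
    (x ∧ y) ∧ ((x ∨ z) ∧ y) ≈⟨ ⊢mem₁ ⟩
    (x ∧ y) ∧ ((x ∧ y) ∨ (x ′ ∧ (z ∧ y))) ≈⟨ ⊢absorption ⟩
    x ∧ y ∎

  x∧⟨⟨x∨y⟩∧x⟩≈x : E ⊢ x ∧ ((x ∨ y) ∧ x) ≈ x
  x∧⟨⟨x∨y⟩∧x⟩≈x =
    x ∧ ((x ∨ y) ∧ x) ≈⟨ x∧x≈x ⟩
    (x ∧ x) ∧ ((x ∨ y) ∧ x) ≈⟨ ⟨x∧y⟩∧⟨⟨x∨z⟩∧y⟩≈x∧y ⟩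
    x ∧ x ≈⟨ x∧x≈x ⟩
    x ∎

  ⟨x∨y⟩∧⟨x′∨y⟩≈⟨x∧y⟩∨y : E ⊢ (x ∨ y) ∧ (x ′ ∨ y) ≈ (x ∧ y) ∨ y
  ⟨x∨y⟩∧⟨x′∨y⟩≈⟨x∧y⟩∨y =
    (x ∨ y) ∧ (x ′ ∨ y) ≈⟨ x∧x≈x ⟩
    (x ∨ y) ∧ (x ′ ∨ (y ∨ y)) ≈⟨ ⊢mem₁ ⟩
    (x ∧ y) ∨ y ∎

  x∧⟨⟨x′∧x⟩∨x⟩≈x : E ⊢ x ∧ ((x ′ ∧ x) ∨ x) ≈ x
  x∧⟨⟨x′∧x⟩∨x⟩≈x =
    x ∧ ((x ′ ∧ x) ∨ x) ≈⟨ x∧x≈x ⟩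
    x ∧ ((x ′ ∧ x) ∨ (x ∧ x)) ≈⟨ ⟨x∨y⟩∧⟨x′∨y⟩≈⟨x∧y⟩∨y ⟩
    x ∧ ((x ′ ∨ x) ∧ x) ≈⟨ x∧x′≈x′∧x ⟩
    x ∧ ((x ∨ x ′) ∧ x) ≈⟨ x∧⟨⟨x∨y⟩∧x⟩≈x ⟩
    x ∎

  ⟨x∨x′⟩∧x≈x : E ⊢ (x ∨ x ′) ∧ x ≈ x
  ⟨x∨x′⟩∧x≈x =
    (x ∨ x ′) ∧ x ≈⟨ x∧⟨x′∨⟨y∨x⟩⟩≈⟨x∧y⟩∨x ⟩
    x ∨ (x ′ ∧ (x ′ ∧ x)) ≈⟨ x∧⟨⟨x′∧x⟩∨x⟩≈x ⟩
    (x ∧ ((x ′ ∧ x) ∨ x)) ∨ (x ′ ∧ (x ′ ∧ x)) ≈⟨ ⟨x∨⟨y∧z⟩⟩∧⟨x′∨y⟩≈⟨x∧y⟩∨⟨y∧z⟩ ⟩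
    (x ∨ (x ′ ∧ x)) ∧ ((x ′ ∧ x) ∨ x) ≈⟨ x∧⟨x′∨x⟩≈x ⟩
    x ∧ ((x ′ ∧ x) ∨ x) ≈⟨ x∧⟨⟨x′∧x⟩∨x⟩≈x ⟩
    x ∎

  ⟨x∨x′⟩∧x′≈x′ : E ⊢ (x ∨ x ′) ∧ x ′ ≈ x ′
  ⟨x∨x′⟩∧x′≈x′ =
    (x ∨ x ′) ∧ x ′ ≈⟨ x∧x′≈x′∧x ⟩
    (x ′ ∨ x) ∧ x ′ ≈⟨ ⟨x∨x′⟩∧x≈x ⟩
    x ′ ∎

  ⟨x∨⟨⟨x∧y⟩∨x′⟩⟩∧x′≈x′ : E ⊢ (x ∨ ((x ∧ y) ∨ x ′)) ∧ x ′ ≈ x ′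
  ⟨x∨⟨⟨x∧y⟩∨x′⟩⟩∧x′≈x′ =
    (x ∨ ((x ∧ y) ∨ x ′)) ∧ x ′ ≈⟨ ⊢mem₁ ⟩
    (x ∧ x ′) ∨ (x ′ ∧ (((x ∧ y) ∨ x ′) ∧ x ′)) ≈⟨ ⊢mem₁ ⟩
    (x ∧ x ′) ∨ (x ′ ∧ (((x ∨ x ′) ∧ (x ′ ∨ (y ∨ x ′))) ∧ x ′)) ≈⟨ x∧x′≈x′∧x ⟩
    (x ∧ x ′) ∨ (x ′ ∧ (((x ′ ∨ x) ∧ (x ′ ∨ (y ∨ x ′))) ∧ x ′)) ≈⟨ x∧⟨x′∨⟨y∨⟨x∧z⟩⟩⟩≈⟨x∧y⟩∨⟨x∧z⟩ ⟩
    (x ∧ x ′) ∨ (x ′ ∧ ((x ′ ∨ (x ∧ (x ∧ (x ′ ∨ (y ∨ x ′))))) ∧ x ′)) ≈⟨ x∧⟨⟨x∨y⟩∧x⟩≈x ⟩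
    (x ∧ x ′) ∨ x ′ ≈⟨ ⟨x∨x′⟩∧x′≈x′ ⟩
    x ′ ∎

  ⟨x∨⟨⟨⟨x∧y⟩∨x⟩∨x′⟩⟩∧x′≈x′ : E ⊢ (x ∨ (((x ∧ y) ∨ x) ∨ x ′)) ∧ x ′ ≈ x ′
  ⟨x∨⟨⟨⟨x∧y⟩∨x⟩∨x′⟩⟩∧x′≈x′ =
    (x ∨ (((x ∧ y) ∨ x) ∨ x ′)) ∧ x ′ ≈⟨ x∧⟨x′∨⟨y∨x⟩⟩≈⟨x∧y⟩∨x ⟩
    (x ∨ ((x ∧ (x ′ ∨ (y ∨ x))) ∨ x ′)) ∧ x ′ ≈⟨ ⟨x∨⟨⟨x∧y⟩∨x′⟩⟩∧x′≈x′ ⟩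
    x ′ ∎

  ⟨x∨⟨y∧y′⟩⟩∧y′≈⟨x∨y⟩∧y′ : E ⊢ (x ∨ (y ∧ y ′)) ∧ y ′ ≈ (x ∨ y) ∧ y ′
  ⟨x∨⟨y∧y′⟩⟩∧y′≈⟨x∨y⟩∧y′ =
    (x ∨ (y ∧ y ′)) ∧ y ′ ≈⟨ ⟨x∨x′⟩∧x′≈x′ ⟩
    (x ∨ (y ∧ y ′)) ∧ ((y ∧ y ′) ∨ y ′) ≈⟨ ⟨x∨⟨y∧z⟩⟩∧⟨x′∨y⟩≈⟨x∧y⟩∨⟨y∧z⟩ ⟩
    (x ∧ ((y ∧ y ′) ∨ y ′)) ∨ (x ′ ∧ (y ∧ y ′)) ≈⟨ ⟨x∨x′⟩∧x′≈x′ ⟩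
    (x ∧ y ′) ∨ (x ′ ∧ (y ∧ y ′)) ≈⟨ ⊢mem₁ ⟩
    (x ∨ y) ∧ y ′ ∎

  ⟨x∨x′⟩∧⟨x′∧x⟩≈x′∧x : E ⊢ (x ∨ x ′) ∧ (x ′ ∧ x) ≈ x ′ ∧ x
  ⟨x∨x′⟩∧⟨x′∧x⟩≈x′∧x =
    (x ∨ x ′) ∧ (x ′ ∧ x) ≈⟨ ⊢absorption ⟩
    ((x ∨ x ′) ∨ ((x ∨ x ′) ∧ x ′)) ∧ (x ′ ∧ x) ≈⟨ ⟨x∨x′⟩∧x′≈x′ ⟩
    ((x ∨ x ′) ∨ x ′) ∧ (x ′ ∧ x) ≈⟨ ⟨x∨x′⟩∧x≈x ⟩
    ((x ∨ x ′) ∨ ((x ′ ∧ x) ∨ x ′)) ∧ (x ′ ∧ x) ≈⟨ ⊢mem₁ ⟩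
    ((x ∨ x ′) ∧ (x ′ ∧ x)) ∨ ((x ′ ∧ x) ∧ (((x ′ ∧ x) ∨ x ′) ∧ (x ′ ∧ x))) ≈⟨ x∧⟨⟨x∨y⟩∧x⟩≈x ⟩
    ((x ∨ x ′) ∧ (x ′ ∧ x)) ∨ (x ′ ∧ x) ≈⟨ ⟨x∨x′⟩∧x′≈x′ ⟩
    x ′ ∧ x ∎

  ⟨x∨x′⟩∧⟨x∧x′⟩≈x′∧x : E ⊢ (x ∨ x ′) ∧ (x ∧ x ′) ≈ x ′ ∧ x
  ⟨x∨x′⟩∧⟨x∧x′⟩≈x′∧x =
    (x ∨ x ′) ∧ (x ∧ x ′) ≈⟨ x∧x′≈x′∧x ⟩
    (x ∨ x ′) ∧ (x ′ ∧ x) ≈⟨ ⟨x∨x′⟩∧⟨x′∧x⟩≈x′∧x ⟩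
    x ′ ∧ x ∎

  ⟨⟨x∨x′⟩∨y⟩∧⟨x∧x′⟩≈x′∧x : E ⊢ ((x ∨ x ′) ∨ y) ∧ (x ∧ x ′) ≈ x ′ ∧ x
  ⟨⟨x∨x′⟩∨y⟩∧⟨x∧x′⟩≈x′∧x =
    ((x ∨ x ′) ∨ y) ∧ (x ∧ x ′) ≈⟨ ⊢mem₁ ⟩
    ((x ∨ x ′) ∧ (x ∧ x ′)) ∨ ((x ′ ∧ x) ∧ (y ∧ (x ∧ x ′))) ≈⟨ ⟨x∨x′⟩∧⟨x∧x′⟩≈x′∧x ⟩
    (x ′ ∧ x) ∨ ((x ′ ∧ x) ∧ (y ∧ (x ∧ x ′))) ≈⟨ ⊢absorption ⟩
    x ′ ∧ x ∎

  ⟨⟨x∧x′⟩∧y⟩∧⟨x∧x′⟩≈x′∧x : E ⊢ ((x ∧ x ′) ∧ y) ∧ (x ∧ x ′) ≈ x ′ ∧ x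
  ⟨⟨x∧x′⟩∧y⟩∧⟨x∧x′⟩≈x′∧x =
    ((x ∧ x ′) ∧ y) ∧ (x ∧ x ′) ≈⟨ ⟨x∨y⟩∧⟨x′∨x⟩≈x∨y ⟩
    (((x ∧ x ′) ∧ y) ∨ ((x ′ ∨ x) ∧ (x ∧ x ′))) ∧ (x ∧ x ′) ≈⟨ ⟨x∨⟨y∧y′⟩⟩∧y′≈⟨x∨y⟩∧y′ ⟩
    (((x ∧ x ′) ∧ y) ∨ (x ′ ∨ x)) ∧ (x ∧ x ′) ≈⟨ x∧x′≈x′∧x ⟩
    (((x ′ ∧ x) ∧ y) ∨ (x ′ ∨ x)) ∧ (x ∧ x ′) ≈⟨ ⟨⟨x∨x′⟩∨y⟩∧⟨x∧x′⟩≈x′∧x ⟩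
    (x ∨ x ′) ∧ (x ∧ x ′) ≈⟨ ⟨x∨x′⟩∧⟨x∧x′⟩≈x′∧x ⟩
    x ′ ∧ x ∎

  ⟨x∨x′⟩∧⟨⟨x′∨x⟩∨y⟩≈x∨x′ : E ⊢ (x ∨ x ′) ∧ ((x ′ ∨ x) ∨ y) ≈ x ∨ x ′
  ⟨x∨x′⟩∧⟨⟨x′∨x⟩∨y⟩≈x∨x′ =
    (x ∨ x ′) ∧ ((x ′ ∨ x) ∨ y) ≈⟨ x∧x′≈x′∧x ⟩
    (x ∨ x ′) ∧ ((x ∨ x ′) ∨ y) ≈⟨ ⊢absorption ⟩
    x ∨ x ′ ∎

  ⟨x∨x′⟩∧⟨⟨x∧x′⟩∧y⟩≈x′∧x : E ⊢ (x ∨ x ′) ∧ ((x ∧ x ′) ∧ y) ≈ x ′ ∧ x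
  ⟨x∨x′⟩∧⟨⟨x∧x′⟩∧y⟩≈x′∧x =
    (x ∨ x ′) ∧ ((x ∧ x ′) ∧ y) ≈⟨ x∧x′≈x′∧x ⟩
    (x ∨ x ′) ∧ ((x ′ ∧ x) ∧ y) ≈⟨ x∧⟨x′∧y⟩≈x∧x′ ⟩
    (x ∨ x ′) ∧ (x ′ ∧ x) ≈⟨ ⟨x∨x′⟩∧⟨x′∧x⟩≈x′∧x ⟩
    x ′ ∧ x ∎

  -- In C the value of `x ∧ x′` is F or U, and both are left zeros.
  ⟨x∧x′⟩∧y≈x∧x′ : E ⊢ (x ∧ x ′) ∧ y ≈ x ∧ x ′
  ⟨x∧x′⟩∧y≈x∧x′ =
    (x ∧ x ′) ∧ y ≈⟨ ⟨x∨⟨⟨⟨x∧y⟩∨x⟩∨x′⟩⟩∧x′≈x′ ⟩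
    -- The disjunct put in front of `(x ∧ x′) ∧ y` is chosen to collapse to `x ∧ x′`; absorption
    -- then removes the rest.
    (((x ′ ∨ x) ∨ y ′) ∧ (((((x ′ ∨ x) ∨ y ′) ∨ (x ′ ∨ x)) ∧ ((x ′ ∨ x) ∨ y ′)) ∧ ((x ∧ x ′) ∧ y))) ∨ ((x ∧ x ′) ∧ y) ≈⟨ ⟨⟨x∧x′⟩∧y⟩∧⟨x∧x′⟩≈x′∧x ⟩
    (((x ′ ∨ x) ∨ y ′) ∧ (((x ∨ x ′) ∧ ((x ′ ∨ x) ∨ y ′)) ∧ ((x ∧ x ′) ∧ y))) ∨ ((x ∧ x ′) ∧ y) ≈⟨ ⟨x∨x′⟩∧⟨⟨x′∨x⟩∨y⟩≈x∨x′ ⟩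
    (((x ′ ∨ x) ∨ y ′) ∧ ((x ∨ x ′) ∧ ((x ∧ x ′) ∧ y))) ∨ ((x ∧ x ′) ∧ y) ≈⟨ ⟨x∨x′⟩∧⟨⟨x∧x′⟩∧y⟩≈x′∧x ⟩
    (((x ′ ∨ x) ∨ y ′) ∧ (x ′ ∧ x)) ∨ ((x ∧ x ′) ∧ y) ≈⟨ ⟨⟨x∨x′⟩∨y⟩∧⟨x∧x′⟩≈x′∧x ⟩
    (x ∧ x ′) ∨ ((x ∧ x ′) ∧ y) ≈⟨ ⊢absorption ⟩
    x ∧ x ′ ∎

  x∧⟨⟨x′∧y⟩∨⟨x∨z⟩⟩≈x : E ⊢ x ∧ ((x ′ ∧ y) ∨ (x ∨ z)) ≈ x
  x∧⟨⟨x′∧y⟩∨⟨x∨z⟩⟩≈x =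
    x ∧ ((x ′ ∧ y) ∨ (x ∨ z)) ≈⟨ ⊢mem₁ ⟩
    x ∧ ((x ′ ∨ (x ∨ z)) ∧ (x ∨ (y ∨ (x ∨ z)))) ≈⟨ x∧⟨x′∧y⟩≈x∧x′ ⟩
    x ∧ ((x ′ ∨ x) ∧ (x ∨ (y ∨ (x ∨ z)))) ≈⟨ x∧x′≈x′∧x ⟩
    x ∧ ((x ∨ x ′) ∧ (x ∨ (y ∨ (x ∨ z)))) ≈⟨ ⊢absorption ⟩
    (x ∧ (x ∨ (y ∨ (x ∨ z)))) ∧ ((x ∨ x ′) ∧ (x ∨ (y ∨ (x ∨ z)))) ≈⟨ ⟨x∧y⟩∧⟨⟨x∨z⟩∧y⟩≈x∧y ⟩
    x ∧ (x ∨ (y ∨ (x ∨ z))) ≈⟨ ⊢absorption ⟩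
    x ∎

  ⟨x∨x′⟩∧⟨x∧y⟩≈x∧⟨x∧y⟩ : E ⊢ (x ∨ x ′) ∧ (x ∧ y) ≈ x ∧ (x ∧ y)
  ⟨x∨x′⟩∧⟨x∧y⟩≈x∧⟨x∧y⟩ =
    (x ∨ x ′) ∧ (x ∧ y) ≈⟨ x∧⟨x′∧y⟩≈x∧x′ ⟩
    (x ∨ (x ′ ∨ y ′)) ∧ (x ∧ y) ≈⟨ ⟨x∨⟨y∧y′⟩⟩∧y′≈⟨x∨y⟩∧y′ ⟩
    (x ∨ ((x ′ ∨ y ′) ∧ (x ∧ y))) ∧ (x ∧ y) ≈⟨ x∧⟨⟨x′∧y⟩∨⟨x∨z⟩⟩≈x ⟩
    x ∧ (x ∧ y) ∎

  ⟨x∨x′⟩∧⟨x′∨⟨x′∨y⟩⟩≈x′∨y : E ⊢ (x ∨ x ′) ∧ (x ′ ∨ (x ′ ∨ y)) ≈ x ′ ∨ y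
  ⟨x∨x′⟩∧⟨x′∨⟨x′∨y⟩⟩≈x′∨y =
    (x ∨ x ′) ∧ (x ′ ∨ (x ′ ∨ y)) ≈⟨ ⟨x∧x′⟩∧y≈x∧x′ ⟩
    ((x ∨ x ′) ∨ y) ∧ (x ′ ∨ (x ′ ∨ y)) ≈⟨ ⟨x∨x′⟩∧⟨x∧y⟩≈x∧⟨x∧y⟩ ⟩
    -- The left zero law, dualised, has supplied the `y` that completes the pattern
    -- `(p ∨ r) ∧ (p′ ∨ (q ∨ r))` of the dual of `mem₁`, with `p = x ∨ x′`, `q = x′` and `r = y`.
    ((x ∨ x ′) ∨ y) ∧ ((x ′ ∧ x) ∨ (x ′ ∨ y)) ≈⟨ ⊢mem₁ ⟩
    ((x ∨ x ′) ∧ x ′) ∨ y ≈⟨ ⟨x∨x′⟩∧x′≈x′ ⟩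
    x ′ ∨ y ∎

  x∧⟨x′∨⟨x∧y⟩⟩≈x∧⟨x∧y⟩ : E ⊢ x ∧ (x ′ ∨ (x ∧ y)) ≈ x ∧ (x ∧ y)
  x∧⟨x′∨⟨x∧y⟩⟩≈x∧⟨x∧y⟩ =
    x ∧ (x ′ ∨ (x ∧ y)) ≈⟨ ⟨x∨y⟩∧⟨x∨x′⟩≈x∨y ⟩
    x ∧ (x ′ ∨ ((x ∧ y) ∨ (x ∧ x ′))) ≈⟨ x∧⟨x′∨⟨y∨⟨x∧x′⟩⟩⟩≈x∧y ⟩
    x ∧ (x ∧ y) ∎

  -- In C, `x ∨ x′` only tests whether `x` is defined, and `x′ ∨ y` begins with that test anyway.
  ⟨x∨x′⟩∧⟨x′∨y⟩≈x′∨y : E ⊢ (x ∨ x ′) ∧ (x ′ ∨ y) ≈ x ′ ∨ y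
  ⟨x∨x′⟩∧⟨x′∨y⟩≈x′∨y =
    (x ∨ x ′) ∧ (x ′ ∨ y) ≈⟨ ⟨x∨x′⟩∧⟨x′∨⟨x′∨y⟩⟩≈x′∨y ⟩
    (x ∨ x ′) ∧ ((x ∨ x ′) ∧ (x ′ ∨ (x ′ ∨ y))) ≈⟨ x∧⟨x′∨⟨x∧y⟩⟩≈x∧⟨x∧y⟩ ⟩
    (x ∨ x ′) ∧ ((x ′ ∧ x) ∨ ((x ∨ x ′) ∧ (x ′ ∨ (x ′ ∨ y)))) ≈⟨ ⟨x∨x′⟩∧⟨x′∨⟨x′∨y⟩⟩≈x′∨y ⟩
    (x ∨ x ′) ∧ ((x ′ ∧ x) ∨ (x ′ ∨ y)) ≈⟨ ⟨x∨x′⟩∧⟨x∧y⟩≈x∧⟨x∧y⟩ ⟩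
    (x ∨ x ′) ∧ (x ′ ∨ (x ′ ∨ y)) ≈⟨ ⟨x∨x′⟩∧⟨x′∨⟨x′∨y⟩⟩≈x′∨y ⟩
    x ′ ∨ y ∎

  x∧⟨x∧y⟩≈x∧y : E ⊢ x ∧ (x ∧ y) ≈ x ∧ y
  x∧⟨x∧y⟩≈x∧y =
    x ∧ (x ∧ y) ≈⟨ ⟨x∨x′⟩∧⟨x′∨y⟩≈x′∨y ⟩
    (x ′ ∧ x) ∨ (x ∧ (x ∧ y)) ≈⟨ ⟨x∨x′⟩∧⟨x′∨⟨x′∨y⟩⟩≈x′∨y ⟩
    x ∧ y ∎

  ⟨x∨y⟩∧x′≈x′∧⟨y∧x′⟩ : E ⊢ (x ∨ y) ∧ x ′ ≈ x ′ ∧ (y ∧ x ′)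
  ⟨x∨y⟩∧x′≈x′∧⟨y∧x′⟩ =
    (x ∨ y) ∧ x ′ ≈⟨ ⊢mem₁ ⟩
    (x ∧ x ′) ∨ (x ′ ∧ (y ∧ x ′)) ≈⟨ ⟨x∨x′⟩∧⟨x′∨y⟩≈x′∨y ⟩
    x ′ ∧ (y ∧ x ′) ∎

  x∧⟨x′∨⟨x∧y⟩⟩≈x∧y : E ⊢ x ∧ (x ′ ∨ (x ∧ y)) ≈ x ∧ y
  x∧⟨x′∨⟨x∧y⟩⟩≈x∧y =
    x ∧ (x ′ ∨ (x ∧ y)) ≈⟨ x∧⟨x′∨⟨x∧y⟩⟩≈x∧⟨x∧y⟩ ⟩
    x ∧ (x ∧ y) ≈⟨ x∧⟨x∧y⟩≈x∧y ⟩
    x ∧ y ∎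

  -- Reduces the law `x ∧ (x′ ∨ y) ≈ x ∧ y` to `x ∧ (y ∧ x) ≈ x ∧ y`.
  x∧⟨y∧x⟩≈x∧⟨x′∨y⟩ : E ⊢ x ∧ (y ∧ x) ≈ x ∧ (x ′ ∨ y)
  x∧⟨y∧x⟩≈x∧⟨x′∨y⟩ =
    x ∧ (y ∧ x) ≈⟨ ⟨x∨y⟩∧x′≈x′∧⟨y∧x′⟩ ⟩
    (x ′ ∨ y) ∧ x ≈⟨ ⊢absorption ⟩
    (x ′ ∨ y) ∧ (x ∨ (x ∧ (x ′ ∨ y))) ≈⟨ x∧⟨x′∨⟨x∧y⟩⟩≈x∧y ⟩
    (x ′ ∨ (x ∧ (x ′ ∨ y))) ∧ (x ∨ (x ∧ (x ′ ∨ y))) ≈⟨ ⟨x∨y⟩∧⟨x′∨y⟩≈⟨x∧y⟩∨y ⟩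
    (x ′ ∧ (x ∧ (x ′ ∨ y))) ∨ (x ∧ (x ′ ∨ y)) ≈⟨ x∧⟨x′∧y⟩≈x∧x′ ⟩
    (x ′ ∧ x) ∨ (x ∧ (x ′ ∨ y)) ≈⟨ ⟨x∨x′⟩∧⟨x′∨y⟩≈x′∨y ⟩
    x ∧ (x ′ ∨ y) ∎

  x∧⟨⟨y∨x′⟩∧x⟩≈x∧y : E ⊢ x ∧ ((y ∨ x ′) ∧ x) ≈ x ∧ y
  x∧⟨⟨y∨x′⟩∧x⟩≈x∧y =
    x ∧ ((y ∨ x ′) ∧ x) ≈⟨ ⟨x∨y⟩∧x′≈x′∧⟨y∧x′⟩ ⟩
    (x ′ ∨ (y ∨ x ′)) ∧ x ≈⟨ ⊢absorption ⟩
    (x ′ ∨ (y ∨ x ′)) ∧ (x ∨ (x ∧ y)) ≈⟨ x∧⟨y∧x⟩≈x∧⟨x′∨y⟩ ⟩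
    (x ′ ∨ (x ∧ y)) ∧ (x ∨ (x ∧ y)) ≈⟨ ⟨x∨y⟩∧⟨x′∨y⟩≈⟨x∧y⟩∨y ⟩
    (x ′ ∧ (x ∧ y)) ∨ (x ∧ y) ≈⟨ x∧⟨x′∧y⟩≈x∧x′ ⟩
    (x ′ ∧ x) ∨ (x ∧ y) ≈⟨ ⟨x∨x′⟩∧⟨x′∨y⟩≈x′∨y ⟩
    x ∧ y ∎

  ⟨x∧y⟩∧x≈x∧y : E ⊢ (x ∧ y) ∧ x ≈ x ∧ y
  ⟨x∧y⟩∧x≈x∧y =
    (x ∧ y) ∧ x ≈⟨ x∧⟨⟨y∨x′⟩∧x⟩≈x∧y ⟩
    (x ∧ y) ∧ ((x ∨ (x ′ ∨ y ′)) ∧ (x ∧ y)) ≈⟨ x∧⟨x′∧y⟩≈x∧x′ ⟩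
    (x ∧ y) ∧ ((x ∨ x ′) ∧ (x ∧ y)) ≈⟨ ⟨x∨x′⟩∧⟨x∧y⟩≈x∧⟨x∧y⟩ ⟩
    (x ∧ y) ∧ (x ∧ (x ∧ y)) ≈⟨ x∧⟨x∧y⟩≈x∧y ⟩
    (x ∧ y) ∧ (x ∧ y) ≈⟨ x∧x≈x ⟩
    x ∧ y ∎

  ⟨⟨x∧y⟩∨x⟩∧y≈⟨x∧y⟩∧y : E ⊢ ((x ∧ y) ∨ x) ∧ y ≈ (x ∧ y) ∧ y
  ⟨⟨x∧y⟩∨x⟩∧y≈⟨x∧y⟩∧y =
    ((x ∧ y) ∨ x) ∧ y ≈⟨ ⊢mem₁ ⟩
    ((x ∧ y) ∧ y) ∨ ((x ′ ∨ y ′) ∧ (x ∧ y)) ≈⟨ ⟨x∨y⟩∧⟨x′∨x⟩≈x∨y ⟩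
    (x ∧ y) ∧ y ∎

  -- Both sides split into the cases `(x ∧ y) ∨ (x′ ∧ y)`.
  ⟨x∨x′⟩∧y≈⟨x∨y⟩∧y : E ⊢ (x ∨ x ′) ∧ y ≈ (x ∨ y) ∧ y
  ⟨x∨x′⟩∧y≈⟨x∨y⟩∧y =
    (x ∨ x ′) ∧ y ≈⟨ ⊢mem₁ ⟩
    (x ∧ y) ∨ (x ′ ∧ (x ′ ∧ y)) ≈⟨ x∧⟨x∧y⟩≈x∧y ⟩
    (x ∧ y) ∨ (x ′ ∧ y) ≈⟨ ⟨x∨y⟩∧⟨x′∨y⟩≈⟨x∧y⟩∨y ⟩
    (x ∨ y) ∧ y ∎

  ⟨x∨x′⟩∧⟨⟨x′∧x⟩∨⟨y∨z⟩⟩≈⟨⟨x∨x′⟩∧y⟩∨z : E ⊢ (x ∨ x ′) ∧ ((x ′ ∧ x) ∨ (y ∨ z)) ≈ ((x ∨ x ′) ∧ y) ∨ z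
  ⟨x∨x′⟩∧⟨⟨x′∧x⟩∨⟨y∨z⟩⟩≈⟨⟨x∨x′⟩∧y⟩∨z =
    (x ∨ x ′) ∧ ((x ′ ∧ x) ∨ (y ∨ z)) ≈⟨ ⟨x∧x′⟩∧y≈x∧x′ ⟩
    ((x ∨ x ′) ∨ z) ∧ ((x ′ ∧ x) ∨ (y ∨ z)) ≈⟨ ⊢mem₁ ⟩
    ((x ∨ x ′) ∧ y) ∨ z ∎

  ⟨x∧y⟩∧y≈x∧y : E ⊢ (x ∧ y) ∧ y ≈ x ∧ y
  ⟨x∧y⟩∧y≈x∧y =
    (x ∧ y) ∧ y ≈⟨ ⟨⟨x∧y⟩∨x⟩∧y≈⟨x∧y⟩∧y ⟩
    ((x ∧ y) ∨ x) ∧ y ≈⟨ ⟨x∧y⟩∧x≈x∧y ⟩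
    (((x ∧ y) ∧ x) ∨ x) ∧ y ≈⟨ ⟨x∨x′⟩∧y≈⟨x∨y⟩∧y ⟩
    -- With `p = x ∧ y`, the disjunction `(p ∧ x) ∨ x` has been traded for `(p ∧ p′) ∨ x`.
    -- Regrouping now brings `y` next to `x`, which reproduces `p`.
    (((x ∧ y) ∧ (x ′ ∨ y ′)) ∨ x) ∧ y ≈⟨ ⟨x∨x′⟩∧⟨⟨x′∧x⟩∨⟨y∨z⟩⟩≈⟨⟨x∨x′⟩∧y⟩∨z ⟩
    ((x ∧ y) ∧ (x ′ ∨ y ′)) ∨ (((x ′ ∨ y ′) ∨ (x ∧ y)) ∧ (x ∧ y)) ≈⟨ ⟨x∨x′⟩∧x′≈x′ ⟩
    ((x ∧ y) ∧ (x ′ ∨ y ′)) ∨ (x ∧ y) ≈⟨ ⟨x∨x′⟩∧x≈x ⟩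
    x ∧ y ∎

  x∧⟨y∨x′⟩≈x∧y : E ⊢ x ∧ (y ∨ x ′) ≈ x ∧ y
  x∧⟨y∨x′⟩≈x∧y =
    x ∧ (y ∨ x ′) ≈⟨ x∧⟨⟨y∨x′⟩∧x⟩≈x∧y ⟩
    x ∧ (((y ∨ x ′) ∨ x ′) ∧ x) ≈⟨ ⟨x∧y⟩∧y≈x∧y ⟩
    x ∧ ((y ∨ x ′) ∧ x) ≈⟨ x∧⟨⟨y∨x′⟩∧x⟩≈x∧y ⟩
    x ∧ y ∎

  x∧⟨y∧x′⟩≈x∧⟨y∧y′⟩ : E ⊢ x ∧ (y ∧ x ′) ≈ x ∧ (y ∧ y ′)
  x∧⟨y∧x′⟩≈x∧⟨y∧y′⟩ =
    x ∧ (y ∧ x ′) ≈⟨ x∧⟨⟨y∨x′⟩∧x⟩≈x∧y ⟩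
    x ∧ (((y ∧ x ′) ∨ x ′) ∧ x) ≈⟨ ⟨x∨x′⟩∧y≈⟨x∨y⟩∧y ⟩
    x ∧ (((y ∧ y ′) ∨ x ′) ∧ x) ≈⟨ x∧⟨⟨y∨x′⟩∧x⟩≈x∧y ⟩
    x ∧ (y ∧ y ′) ∎

  ⟨x∨y⟩∧x≈x∨⟨y∧y′⟩ : E ⊢ (x ∨ y) ∧ x ≈ x ∨ (y ∧ y ′)
  ⟨x∨y⟩∧x≈x∨⟨y∧y′⟩ =
    (x ∨ y) ∧ x ≈⟨ ⊢mem₁ ⟩
    (x ∧ x) ∨ (x ′ ∧ (y ∧ x)) ≈⟨ x∧⟨y∧x′⟩≈x∧⟨y∧y′⟩ ⟩
    (x ∧ x) ∨ (x ′ ∧ (y ∧ y ′)) ≈⟨ x∧x≈x ⟩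
    x ∨ (x ′ ∧ (y ∧ y ′)) ≈⟨ ⟨x∧x′⟩∧y≈x∧x′ ⟩
    x ∨ (x ′ ∧ ((y ∧ y ′) ∧ (x ∨ x ′))) ≈⟨ x∧⟨x′∨⟨y∨⟨x∧x′⟩⟩⟩≈x∧y ⟩
    x ∨ (y ∧ y ′) ∎

  ⟨x∨y⟩∧x≈x∨⟨y∧x⟩ : E ⊢ (x ∨ y) ∧ x ≈ x ∨ (y ∧ x)
  ⟨x∨y⟩∧x≈x∨⟨y∧x⟩ =
    (x ∨ y) ∧ x ≈⟨ x∧⟨x′∨⟨y∨x⟩⟩≈⟨x∧y⟩∨x ⟩
    x ∨ (x ′ ∧ (y ∧ x)) ≈⟨ x∧x≈x ⟩
    x ∨ (x ′ ∧ ((y ∧ x) ∨ (y ∧ x))) ≈⟨ ⟨x∧y⟩∧y≈x∧y ⟩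
    x ∨ (x ′ ∧ (((y ∧ x) ∧ x) ∨ (y ∧ x))) ≈⟨ ⟨x∨y⟩∧x≈x∨⟨y∧y′⟩ ⟩
    x ∨ (x ′ ∧ ((y ∧ x) ∧ (x ∨ x ′))) ≈⟨ x∧⟨x′∨⟨y∨⟨x∧x′⟩⟩⟩≈x∧y ⟩
    x ∨ (y ∧ x) ∎

  x∧⟨⟨y∨x′⟩∧y⟩≈x∧y : E ⊢ x ∧ ((y ∨ x ′) ∧ y) ≈ x ∧ y
  x∧⟨⟨y∨x′⟩∧y⟩≈x∧y =
    x ∧ ((y ∨ x ′) ∧ y) ≈⟨ x∧⟨y∨x′⟩≈x∧y ⟩
    x ∧ (((y ∨ x ′) ∧ y) ∨ x ′) ≈⟨ ⟨⟨x∧y⟩∨x⟩∧y≈⟨x∧y⟩∧y ⟩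
    x ∧ ((y ∨ x ′) ∨ x ′) ≈⟨ ⟨x∧y⟩∧y≈x∧y ⟩
    x ∧ (y ∨ x ′) ≈⟨ x∧⟨y∨x′⟩≈x∧y ⟩
    x ∧ y ∎

  x∧⟨⟨y∨x⟩∧y⟩≈x∧y : E ⊢ x ∧ ((y ∨ x) ∧ y) ≈ x ∧ y
  x∧⟨⟨y∨x⟩∧y⟩≈x∧y =
    x ∧ ((y ∨ x) ∧ y) ≈⟨ ⊢mem₁ ⟩
    x ∧ ((y ∧ y) ∨ (y ′ ∧ (x ∧ y))) ≈⟨ x∧⟨y∧x′⟩≈x∧⟨y∧y′⟩ ⟩
    x ∧ ((y ∧ y) ∨ (y ′ ∧ (x ∧ x ′))) ≈⟨ x∧x′≈x′∧x ⟩
    x ∧ ((y ∧ y) ∨ (y ′ ∧ (x ′ ∧ x))) ≈⟨ x∧⟨y∧x′⟩≈x∧⟨y∧y′⟩ ⟩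
    x ∧ ((y ∧ y) ∨ (y ′ ∧ (x ′ ∧ y))) ≈⟨ ⊢mem₁ ⟩
    x ∧ ((y ∨ x ′) ∧ y) ≈⟨ x∧⟨⟨y∨x′⟩∧y⟩≈x∧y ⟩
    x ∧ y ∎

  x∧⟨y∧⟨x′∧y′⟩⟩≈x∧⟨y∧x′⟩ : E ⊢ x ∧ (y ∧ (x ′ ∧ y ′)) ≈ x ∧ (y ∧ x ′)
  x∧⟨y∧⟨x′∧y′⟩⟩≈x∧⟨y∧x′⟩ =
    x ∧ (y ∧ (x ′ ∧ y ′)) ≈⟨ x∧⟨y∨x′⟩≈x∧y ⟩
    x ∧ ((y ∧ (x ′ ∧ y ′)) ∨ x ′) ≈⟨ ⊢mem₁ ⟩
    x ∧ ((y ∨ x ′) ∧ (y ′ ∨ ((x ′ ∧ y ′) ∨ x ′))) ≈⟨ x∧⟨⟨y∨x⟩∧y⟩≈x∧y ⟩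
    x ∧ ((y ∨ x ′) ∧ (y ′ ∨ x ′)) ≈⟨ ⟨x∨y⟩∧⟨x′∨y⟩≈⟨x∧y⟩∨y ⟩
    x ∧ ((y ∧ x ′) ∨ x ′) ≈⟨ x∧⟨y∨x′⟩≈x∧y ⟩
    x ∧ (y ∧ x ′) ∎

  ⟨x∨y⟩∧⟨x∧y′⟩≈⟨x∨y⟩∧y′ : E ⊢ (x ∨ y) ∧ (x ∧ y ′) ≈ (x ∨ y) ∧ y ′
  ⟨x∨y⟩∧⟨x∧y′⟩≈⟨x∨y⟩∧y′ =
    (x ∨ y) ∧ (x ∧ y ′) ≈⟨ ⊢mem₁ ⟩
    (x ∧ (x ∧ y ′)) ∨ (x ′ ∧ (y ∧ (x ∧ y ′))) ≈⟨ x∧⟨y∧⟨x′∧y′⟩⟩≈x∧⟨y∧x′⟩ ⟩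
    (x ∧ (x ∧ y ′)) ∨ (x ′ ∧ (y ∧ x)) ≈⟨ x∧⟨x∧y⟩≈x∧y ⟩
    (x ∧ y ′) ∨ (x ′ ∧ (y ∧ x)) ≈⟨ x∧⟨y∧x′⟩≈x∧⟨y∧y′⟩ ⟩
    (x ∧ y ′) ∨ (x ′ ∧ (y ∧ y ′)) ≈⟨ ⊢mem₁ ⟩
    (x ∨ y) ∧ y ′ ∎

  ⟨x∨y⟩∧⟨⟨x∧z⟩∨y⟩≈⟨x∧z⟩∨y : E ⊢ (x ∨ y) ∧ ((x ∧ z) ∨ y) ≈ (x ∧ z) ∨ y
  ⟨x∨y⟩∧⟨⟨x∧z⟩∨y⟩≈⟨x∧z⟩∨y =
    (x ∨ y) ∧ ((x ∧ z) ∨ y) ≈⟨ ⊢mem₁ ⟩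
    (x ∨ y) ∧ ((x ∨ y) ∧ (x ′ ∨ (z ∨ y))) ≈⟨ x∧⟨x∧y⟩≈x∧y ⟩
    (x ∨ y) ∧ (x ′ ∨ (z ∨ y)) ≈⟨ ⊢mem₁ ⟩
    (x ∧ z) ∨ y ∎

  -- Dually `(x ∧ y) ∨ (y′ ∧ y) ≈ (x ∨ y′) ∧ y`, the fragment of right distributivity on which
  -- `x∧⟨y∧x⟩≈x∧y` rests.
  ⟨x∨y⟩∧⟨y′∨y⟩≈⟨x∧y′⟩∨y : E ⊢ (x ∨ y) ∧ (y ′ ∨ y) ≈ (x ∧ y ′) ∨ y
  ⟨x∨y⟩∧⟨y′∨y⟩≈⟨x∧y′⟩∨y =
    (x ∨ y) ∧ (y ′ ∨ y) ≈⟨ ⟨x∨y⟩∧x≈x∨⟨y∧y′⟩ ⟩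
    ((x ∨ y) ∧ y ′) ∨ (x ∨ y) ≈⟨ ⟨x∨y⟩∧⟨x∧y′⟩≈⟨x∨y⟩∧y′ ⟩
    ((x ∨ y) ∧ (x ∧ y ′)) ∨ (x ∨ y) ≈⟨ ⟨x∨y⟩∧x≈x∨⟨y∧x⟩ ⟩
    (x ∨ y) ∧ ((x ∧ y ′) ∨ (x ∨ y)) ≈⟨ ⟨x∨y⟩∧⟨x∧y′⟩≈⟨x∨y⟩∧y′ ⟩
    (x ∨ y) ∧ ((x ∧ y ′) ∨ y) ≈⟨ ⟨x∨y⟩∧⟨⟨x∧z⟩∨y⟩≈⟨x∧z⟩∨y ⟩
    (x ∧ y ′) ∨ y ∎

  x∧⟨y∧x⟩≈x∧y : E ⊢ x ∧ (y ∧ x) ≈ x ∧ y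
  x∧⟨y∧x⟩≈x∧y =
    x ∧ (y ∧ x) ≈⟨ x∧⟨x′∨⟨y∨⟨x∧x′⟩⟩⟩≈x∧y ⟩
    x ∧ (x ′ ∨ ((y ∧ x) ∨ (x ∧ x ′))) ≈⟨ ⟨x∧y⟩∧y≈x∧y ⟩
    x ∧ (x ′ ∨ (((y ∧ x) ∨ (x ∧ x ′)) ∨ (x ∧ x ′))) ≈⟨ x∧⟨x′∨⟨y∨⟨x∧x′⟩⟩⟩≈x∧y ⟩
    x ∧ ((y ∧ x) ∨ (x ∧ x ′)) ≈⟨ x∧x′≈x′∧x ⟩
    x ∧ ((y ∧ x) ∨ (x ′ ∧ x)) ≈⟨ ⟨x∨y⟩∧⟨y′∨y⟩≈⟨x∧y′⟩∨y ⟩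
    x ∧ ((y ∨ x ′) ∧ x) ≈⟨ x∧⟨⟨y∨x′⟩∧x⟩≈x∧y ⟩
    x ∧ y ∎

  x∧⟨x′∨y⟩≈x∧y : E ⊢ x ∧ (x ′ ∨ y) ≈ x ∧ y
  x∧⟨x′∨y⟩≈x∧y =
    x ∧ (x ′ ∨ y) ≈⟨ x∧⟨y∧x⟩≈x∧⟨x′∨y⟩ ⟩
    x ∧ (y ∧ x) ≈⟨ x∧⟨y∧x⟩≈x∧y ⟩
    x ∧ y ∎

  ⟨x∨x′⟩∧⟨x∨y⟩≈x∨y : E ⊢ (x ∨ x ′) ∧ (x ∨ y) ≈ x ∨ y
  ⟨x∨x′⟩∧⟨x∨y⟩≈x∨y =
    (x ∨ x ′) ∧ (x ∨ y) ≈⟨ ⊢mem₁ ⟩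
    (x ∧ (x ∨ y)) ∨ (x ′ ∧ (x ′ ∧ (x ∨ y))) ≈⟨ ⊢absorption ⟩
    x ∨ (x ′ ∧ (x ′ ∧ (x ∨ y))) ≈⟨ x∧⟨x∧y⟩≈x∧y ⟩
    x ∨ (x ′ ∧ (x ∨ y)) ≈⟨ x∧⟨x′∨y⟩≈x∧y ⟩
    x ∨ (x ∨ y) ≈⟨ x∧⟨x∧y⟩≈x∧y ⟩
    x ∨ y ∎

  x∧⟨⟨x′∨y⟩∧z⟩≈x∧⟨y∧z⟩ : E ⊢ x ∧ ((x ′ ∨ y) ∧ z) ≈ x ∧ (y ∧ z)
  x∧⟨⟨x′∨y⟩∧z⟩≈x∧⟨y∧z⟩ =
    x ∧ ((x ′ ∨ y) ∧ z) ≈⟨ x∧⟨x′∨y⟩≈x∧y ⟩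
    x ∧ (x ′ ∨ ((x ′ ∨ y) ∧ z)) ≈⟨ ⊢mem₁ ⟩
    x ∧ (x ′ ∨ ((x ′ ∧ z) ∨ (x ∧ (y ∧ z)))) ≈⟨ ⊢absorption ⟩
    (x ∨ (x ∧ (y ∧ z))) ∧ (x ′ ∨ ((x ′ ∧ z) ∨ (x ∧ (y ∧ z)))) ≈⟨ ⊢mem₁ ⟩
    (x ∧ (x ′ ∧ z)) ∨ (x ∧ (y ∧ z)) ≈⟨ x∧⟨x′∧y⟩≈x∧x′ ⟩
    -- The case `x′` of the split of `(x′ ∨ y) ∧ z` has shrunk to `x ∧ x′`, which is neutral in
    -- front of a term beginning with `x`.
    (x ∧ x ′) ∨ (x ∧ (y ∧ z)) ≈⟨ ⟨x∨x′⟩∧⟨x∨y⟩≈x∨y ⟩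
    x ∧ (y ∧ z) ∎

  x∧⟨⟨x∧y⟩∧z⟩≈x∧⟨y∧z⟩ : E ⊢ x ∧ ((x ∧ y) ∧ z) ≈ x ∧ (y ∧ z)
  x∧⟨⟨x∧y⟩∧z⟩≈x∧⟨y∧z⟩ =
    x ∧ ((x ∧ y) ∧ z) ≈⟨ x∧⟨⟨x′∨y⟩∧z⟩≈x∧⟨y∧z⟩ ⟩
    x ∧ ((x ′ ∨ (x ∧ y)) ∧ z) ≈⟨ x∧⟨x′∨y⟩≈x∧y ⟩
    x ∧ ((x ′ ∨ y) ∧ z) ≈⟨ x∧⟨⟨x′∨y⟩∧z⟩≈x∧⟨y∧z⟩ ⟩
    x ∧ (y ∧ z) ∎

  x∧⟨⟨x′∨y⟩∨z⟩≈x∧⟨y∨z⟩ : E ⊢ x ∧ ((x ′ ∨ y) ∨ z) ≈ x ∧ (y ∨ z)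
  x∧⟨⟨x′∨y⟩∨z⟩≈x∧⟨y∨z⟩ =
    x ∧ ((x ′ ∨ y) ∨ z) ≈⟨ x∧⟨x′∨y⟩≈x∧y ⟩
    x ∧ (x ′ ∨ ((x ′ ∨ y) ∨ z)) ≈⟨ x∧⟨⟨x∧y⟩∧z⟩≈x∧⟨y∧z⟩ ⟩
    x ∧ (x ′ ∨ (y ∨ z)) ≈⟨ x∧⟨x′∨y⟩≈x∧y ⟩
    x ∧ (y ∨ z) ∎

  ⟨x∧y⟩∧⟨x∧z⟩≈⟨x∧y⟩∧z : E ⊢ (x ∧ y) ∧ (x ∧ z) ≈ (x ∧ y) ∧ z
  ⟨x∧y⟩∧⟨x∧z⟩≈⟨x∧y⟩∧z =
    (x ∧ y) ∧ (x ∧ z) ≈⟨ x∧⟨⟨x∧y⟩∧z⟩≈x∧⟨y∧z⟩ ⟩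
    (x ∧ y) ∧ (((x ∧ y) ∧ x) ∧ z) ≈⟨ ⟨x∧y⟩∧x≈x∧y ⟩
    (x ∧ y) ∧ ((x ∧ y) ∧ z) ≈⟨ x∧⟨x∧y⟩≈x∧y ⟩
    (x ∧ y) ∧ z ∎

  ⟨x∧y⟩∧⟨x′∨z⟩≈⟨x∧y⟩∧z : E ⊢ (x ∧ y) ∧ (x ′ ∨ z) ≈ (x ∧ y) ∧ z
  ⟨x∧y⟩∧⟨x′∨z⟩≈⟨x∧y⟩∧z =
    (x ∧ y) ∧ (x ′ ∨ z) ≈⟨ ⟨x∧y⟩∧⟨x∧z⟩≈⟨x∧y⟩∧z ⟩
    (x ∧ y) ∧ (x ∧ (x ′ ∨ z)) ≈⟨ x∧⟨x′∨y⟩≈x∧y ⟩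
    (x ∧ y) ∧ (x ∧ z) ≈⟨ ⟨x∧y⟩∧⟨x∧z⟩≈⟨x∧y⟩∧z ⟩
    (x ∧ y) ∧ z ∎

  x∧⟨y∨⟨x∧z⟩⟩≈x∧⟨y∨z⟩ : E ⊢ x ∧ (y ∨ (x ∧ z)) ≈ x ∧ (y ∨ z)
  x∧⟨y∨⟨x∧z⟩⟩≈x∧⟨y∨z⟩ =
    x ∧ (y ∨ (x ∧ z)) ≈⟨ x∧⟨⟨x′∨y⟩∨z⟩≈x∧⟨y∨z⟩ ⟩
    x ∧ ((x ′ ∨ y) ∨ (x ∧ z)) ≈⟨ ⟨x∧y⟩∧⟨x′∨z⟩≈⟨x∧y⟩∧z ⟩
    x ∧ ((x ′ ∨ y) ∨ z) ≈⟨ x∧⟨⟨x′∨y⟩∨z⟩≈x∧⟨y∨z⟩ ⟩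
    x ∧ (y ∨ z) ∎

  ∧-distributive : E ⊢ x ∧ (y ∨ z) ≈ (x ∧ y) ∨ (x ∧ z)
  ∧-distributive =
    x ∧ (y ∨ z) ≈⟨ x∧⟨y∨⟨x∧z⟩⟩≈x∧⟨y∨z⟩ ⟩
    x ∧ (y ∨ (x ∧ z)) ≈⟨ x∧⟨x′∨y⟩≈x∧y ⟩
    x ∧ (x ′ ∨ (y ∨ (x ∧ z))) ≈⟨ ⊢absorption ⟩
    (x ∨ (x ∧ z)) ∧ (x ′ ∨ (y ∨ (x ∧ z))) ≈⟨ ⊢mem₁ ⟩
    (x ∧ y) ∨ (x ∧ z) ∎

  mem₂-diagonal : E ⊢ (x ∨ y) ∧ y ≈ (x ∧ y) ∨ ((x ′ ∧ y) ∧ y)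
  mem₂-diagonal =
    (x ∨ y) ∧ y ≈⟨ ⊢mem₁ ⟩
    (x ∧ y) ∨ (x ′ ∧ (y ∧ y)) ≈⟨ x∧x≈x ⟩
    (x ∧ y) ∨ (x ′ ∧ y) ≈⟨ ⟨x∧y⟩∧y≈x∧y ⟩
    (x ∧ y) ∨ ((x ′ ∧ y) ∧ y) ∎

  ∧-associative : E ⊢ ∧-associativity
  ∧-associative = Associativity.associative
    ⊢involution ⊢deMorgan ⊢absorption ⊢weak-commutativity ∧-distributive
    mem₂-diagonal x∧x≈x x∧⟨x∧y⟩≈x∧y x∧⟨x′∨y⟩≈x∧y ⟨x∧y⟩∧x≈x∧y x∧⟨⟨x∧y⟩∧z⟩≈x∧⟨y∧z⟩

-- Associativity from the group with distributivity and `mem₂`.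

module GroupIIConsequences {K : Set} {E : List (Equation K)}
  (⊢involution : E ⊢ involution) (⊢deMorgan : E ⊢ deMorgan)
  (⊢∧-distributes-∨ : E ⊢ ∧-distributes-∨) (⊢mem₂ : E ⊢ mem₂)
  (⊢absorption : E ⊢ absorption) (⊢weak-commutativity : E ⊢ weak-commutativity)
  where

  open Calculation ⊢involution ⊢deMorgan

  x∧x≈x : E ⊢ x ∧ x ≈ x
  x∧x≈x =
    x ∧ x ≈⟨ ⊢absorption ⟩
    x ∧ (x ∨ (x ∧ y ′)) ≈⟨ ⊢absorption ⟩
    x ∎

  x∧⟨⟨x′∨y⟩∨x⟩≈⟨x∧y⟩∨x : E ⊢ x ∧ ((x ′ ∨ y) ∨ x) ≈ (x ∧ y) ∨ x
  x∧⟨⟨x′∨y⟩∨x⟩≈⟨x∧y⟩∨x =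
    x ∧ ((x ′ ∨ y) ∨ x) ≈⟨ x∧x≈x ⟩
    (x ∨ x) ∧ ((x ′ ∨ y) ∨ x) ≈⟨ ⊢mem₂ ⟩
    (x ∧ y) ∨ x ∎

  ⟨x∨y⟩∧x≈x∨⟨y∧x⟩ : E ⊢ (x ∨ y) ∧ x ≈ x ∨ (y ∧ x)
  ⟨x∨y⟩∧x≈x∨⟨y∧x⟩ =
    (x ∨ y) ∧ x ≈⟨ x∧x≈x ⟩
    (x ∨ y) ∧ (x ∨ x) ≈⟨ ⊢∧-distributes-∨ ⟩
    x ∨ (y ∧ x) ∎

  ⟨⟨x∨x′⟩∧x⟩∧x≈x : E ⊢ ((x ∨ x ′) ∧ x) ∧ x ≈ x
  ⟨⟨x∨x′⟩∧x⟩∧x≈x =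
    ((x ∨ x ′) ∧ x) ∧ x ≈⟨ x∧⟨⟨x′∨y⟩∨x⟩≈⟨x∧y⟩∨x ⟩
    (x ∨ ((x ′ ∧ x ′) ∧ x)) ∧ x ≈⟨ x∧x≈x ⟩
    (x ∨ (x ′ ∧ x)) ∧ x ≈⟨ ⟨x∨y⟩∧x≈x∨⟨y∧x⟩ ⟩
    x ∨ ((x ′ ∧ x) ∧ x) ≈⟨ x∧⟨⟨x′∨y⟩∨x⟩≈⟨x∧y⟩∨x ⟩
    (x ∨ x) ∧ x ≈⟨ x∧x≈x ⟩
    x ∧ x ≈⟨ x∧x≈x ⟩
    x ∎

  x∧⟨⟨x∨y⟩∨z⟩≈x : E ⊢ x ∧ ((x ∨ y) ∨ z) ≈ x
  x∧⟨⟨x∨y⟩∨z⟩≈x =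
    x ∧ ((x ∨ y) ∨ z) ≈⟨ ⊢∧-distributes-∨ ⟩
    (x ∧ (x ∨ y)) ∨ (x ∧ z) ≈⟨ ⊢absorption ⟩
    x ∨ (x ∧ z) ≈⟨ ⊢absorption ⟩
    x ∎

  ⟨x∨x′⟩∧⟨x′∨x⟩≈x∨x′ : E ⊢ (x ∨ x ′) ∧ (x ′ ∨ x) ≈ x ∨ x ′
  ⟨x∨x′⟩∧⟨x′∨x⟩≈x∨x′ =
    (x ∨ x ′) ∧ (x ′ ∨ x) ≈⟨ x∧⟨⟨x∨y⟩∨z⟩≈x ⟩
    (x ∨ x ′) ∧ ((x ′ ∨ x) ∨ (((x ′ ∨ x) ∧ x ′) ∧ x ′)) ≈⟨ ⟨⟨x∨x′⟩∧x⟩∧x≈x ⟩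
    (x ∨ x ′) ∧ ((x ′ ∨ x) ∨ x ′) ≈⟨ ⊢mem₂ ⟩
    (x ∧ x) ∨ x ′ ≈⟨ x∧x≈x ⟩
    x ∨ x ′ ∎

  x∧x′≈x′∧x : E ⊢ x ∧ x ′ ≈ x ′ ∧ x
  x∧x′≈x′∧x =
    x ∧ x ′ ≈⟨ ⟨x∨x′⟩∧⟨x′∨x⟩≈x∨x′ ⟩
    (x ∧ x ′) ∨ (x ′ ∧ x) ≈⟨ ⊢weak-commutativity ⟩
    (x ′ ∧ x) ∨ (x ∧ x ′) ≈⟨ ⟨x∨x′⟩∧⟨x′∨x⟩≈x∨x′ ⟩
    x ′ ∧ x ∎

  -- The special case of the left zero law for `x ∧ x′` that suffices here.
  ⟨x∧x′⟩∧⟨⟨x∨y⟩∨z⟩≈x∧x′ : E ⊢ (x ∧ x ′) ∧ ((x ∨ y) ∨ z) ≈ x ∧ x ′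
  ⟨x∧x′⟩∧⟨⟨x∨y⟩∨z⟩≈x∧x′ =
    (x ∧ x ′) ∧ ((x ∨ y) ∨ z) ≈⟨ ⊢∧-distributes-∨ ⟩
    ((x ∧ x ′) ∧ (x ∨ y)) ∨ ((x ∧ x ′) ∧ z) ≈⟨ ⟨⟨x∨x′⟩∧x⟩∧x≈x ⟩
    ((x ∧ x ′) ∧ ((((x ∧ x ′) ∨ x) ∨ x) ∨ y)) ∨ ((x ∧ x ′) ∧ z) ≈⟨ ⊢∧-distributes-∨ ⟩
    (((x ∧ x ′) ∧ (((x ∧ x ′) ∨ x) ∨ x)) ∨ ((x ∧ x ′) ∧ y)) ∨ ((x ∧ x ′) ∧ z) ≈⟨ x∧⟨⟨x∨y⟩∨z⟩≈x ⟩
    ((x ∧ x ′) ∨ ((x ∧ x ′) ∧ y)) ∨ ((x ∧ x ′) ∧ z) ≈⟨ ⊢absorption ⟩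
    (x ∧ x ′) ∨ ((x ∧ x ′) ∧ z) ≈⟨ ⊢absorption ⟩
    x ∧ x ′ ∎

  x∧⟨⟨x′∨y⟩∨⟨x∧z⟩⟩≈x∧⟨y∨z⟩ : E ⊢ x ∧ ((x ′ ∨ y) ∨ (x ∧ z)) ≈ x ∧ (y ∨ z)
  x∧⟨⟨x′∨y⟩∨⟨x∧z⟩⟩≈x∧⟨y∨z⟩ =
    x ∧ ((x ′ ∨ y) ∨ (x ∧ z)) ≈⟨ ⊢absorption ⟩
    (x ∨ (x ∧ z)) ∧ ((x ′ ∨ y) ∨ (x ∧ z)) ≈⟨ ⊢mem₂ ⟩
    (x ∧ y) ∨ (x ∧ z) ≈⟨ ⊢∧-distributes-∨ ⟩
    x ∧ (y ∨ z) ∎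

  x∧⟨x′∨x⟩≈x : E ⊢ x ∧ (x ′ ∨ x) ≈ x
  x∧⟨x′∨x⟩≈x =
    x ∧ (x ′ ∨ x) ≈⟨ x∧x′≈x′∧x ⟩
    x ∧ (x ∨ x ′) ≈⟨ ⊢absorption ⟩
    x ∎

  ⟨x∨x′⟩∧x′≈x′ : E ⊢ (x ∨ x ′) ∧ x ′ ≈ x ′
  ⟨x∨x′⟩∧x′≈x′ =
    (x ∨ x ′) ∧ x ′ ≈⟨ x∧x′≈x′∧x ⟩
    (x ′ ∨ x) ∧ x ′ ≈⟨ ⟨x∨y⟩∧x≈x∨⟨y∧x⟩ ⟩
    x ′ ∨ (x ∧ x ′) ≈⟨ x∧⟨x′∨x⟩≈x ⟩
    x ′ ∎

  ⟨⟨x∨x′⟩∨y⟩∧⟨x′∨y⟩≈x′∨y : E ⊢ ((x ∨ x ′) ∨ y) ∧ (x ′ ∨ y) ≈ x ′ ∨ y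
  ⟨⟨x∨x′⟩∨y⟩∧⟨x′∨y⟩≈x′∨y =
    ((x ∨ x ′) ∨ y) ∧ (x ′ ∨ y) ≈⟨ x∧⟨x′∨x⟩≈x ⟩
    ((x ∨ x ′) ∨ y) ∧ ((x ′ ∧ (x ∨ x ′)) ∨ y) ≈⟨ ⊢∧-distributes-∨ ⟩
    ((x ∨ x ′) ∨ y) ∧ (((x ′ ∧ x) ∨ (x ′ ∧ x ′)) ∨ y) ≈⟨ ⊢mem₂ ⟩
    ((x ∨ x ′) ∧ (x ′ ∧ x ′)) ∨ y ≈⟨ x∧x≈x ⟩
    ((x ∨ x ′) ∧ x ′) ∨ y ≈⟨ ⟨x∨x′⟩∧x′≈x′ ⟩
    x ′ ∨ y ∎

  x∧⟨x′∨⟨y∨z⟩⟩≈x∧⟨y∨z⟩ : E ⊢ x ∧ (x ′ ∨ (y ∨ z)) ≈ x ∧ (y ∨ z)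
  x∧⟨x′∨⟨y∨z⟩⟩≈x∧⟨y∨z⟩ =
    x ∧ (x ′ ∨ (y ∨ z)) ≈⟨ ⊢∧-distributes-∨ ⟩
    (x ∧ x ′) ∨ (x ∧ (y ∨ z)) ≈⟨ x∧x′≈x′∧x ⟩
    (x ′ ∧ x) ∨ (x ∧ (y ∨ z)) ≈⟨ ⟨x∧x′⟩∧⟨⟨x∨y⟩∨z⟩≈x∧x′ ⟩
    -- Both disjuncts are given the right factor `(x′ ∨ y) ∨ (x ∧ z)`, so that the dual of
    -- `⟨⟨x∨x′⟩∨y⟩∧⟨x′∨y⟩≈x′∨y` can delete the first.
    ((x ′ ∧ x) ∧ ((x ′ ∨ y) ∨ (x ∧ z))) ∨ (x ∧ (y ∨ z)) ≈⟨ x∧⟨⟨x′∨y⟩∨⟨x∧z⟩⟩≈x∧⟨y∨z⟩ ⟩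
    ((x ′ ∧ x) ∧ ((x ′ ∨ y) ∨ (x ∧ z))) ∨ (x ∧ ((x ′ ∨ y) ∨ (x ∧ z))) ≈⟨ ⟨⟨x∨x′⟩∨y⟩∧⟨x′∨y⟩≈x′∨y ⟩
    x ∧ ((x ′ ∨ y) ∨ (x ∧ z)) ≈⟨ x∧⟨⟨x′∨y⟩∨⟨x∧z⟩⟩≈x∧⟨y∨z⟩ ⟩
    x ∧ (y ∨ z) ∎

  x∧⟨x′∨y⟩≈x∧y : E ⊢ x ∧ (x ′ ∨ y) ≈ x ∧ y
  x∧⟨x′∨y⟩≈x∧y =
    x ∧ (x ′ ∨ y) ≈⟨ ⊢absorption ⟩
    -- Absorption turns an arbitrary `y` into the disjunction required by the preceding law.
    x ∧ (x ′ ∨ (y ∨ (y ∧ z ′))) ≈⟨ x∧⟨x′∨⟨y∨z⟩⟩≈x∧⟨y∨z⟩ ⟩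
    x ∧ (y ∨ (y ∧ z ′)) ≈⟨ ⊢absorption ⟩
    x ∧ y ∎

  x∧⟨x∧y⟩≈x∧y : E ⊢ x ∧ (x ∧ y) ≈ x ∧ y
  x∧⟨x∧y⟩≈x∧y =
    x ∧ (x ∧ y) ≈⟨ x∧⟨x′∨y⟩≈x∧y ⟩
    x ∧ (x ′ ∨ (x ∧ y)) ≈⟨ x∧⟨x′∨y⟩≈x∧y ⟩
    x ∧ (x ′ ∨ y) ≈⟨ x∧⟨x′∨y⟩≈x∧y ⟩
    x ∧ y ∎

  ⟨x∧y⟩∧x≈x∧y : E ⊢ (x ∧ y) ∧ x ≈ x ∧ y
  ⟨x∧y⟩∧x≈x∧y =
    (x ∧ y) ∧ x ≈⟨ ⊢absorption ⟩
    (x ∧ y) ∧ (x ∨ (x ∧ y)) ≈⟨ ⟨x∨y⟩∧x≈x∨⟨y∧x⟩ ⟩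
    ((x ∧ y) ∧ x) ∨ (x ∧ y) ≈⟨ x∧⟨x∧y⟩≈x∧y ⟩
    ((x ∧ y) ∧ x) ∨ (x ∧ (x ∧ y)) ≈⟨ ⊢weak-commutativity ⟩
    (x ∧ (x ∧ y)) ∨ ((x ∧ y) ∧ x) ≈⟨ x∧⟨x∧y⟩≈x∧y ⟩
    (x ∧ y) ∨ ((x ∧ y) ∧ x) ≈⟨ ⊢absorption ⟩
    x ∧ y ∎

  x∧⟨⟨x′∨y⟩∨z⟩≈x∧⟨y∨z⟩ : E ⊢ x ∧ ((x ′ ∨ y) ∨ z) ≈ x ∧ (y ∨ z)
  x∧⟨⟨x′∨y⟩∨z⟩≈x∧⟨y∨z⟩ =
    x ∧ ((x ′ ∨ y) ∨ z) ≈⟨ ⊢∧-distributes-∨ ⟩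
    (x ∧ (x ′ ∨ y)) ∨ (x ∧ z) ≈⟨ x∧⟨x′∨y⟩≈x∧y ⟩
    (x ∧ y) ∨ (x ∧ z) ≈⟨ ⊢∧-distributes-∨ ⟩
    x ∧ (y ∨ z) ∎

  x∧⟨⟨x∧y⟩∧z⟩≈x∧⟨y∧z⟩ : E ⊢ x ∧ ((x ∧ y) ∧ z) ≈ x ∧ (y ∧ z)
  x∧⟨⟨x∧y⟩∧z⟩≈x∧⟨y∧z⟩ =
    x ∧ ((x ∧ y) ∧ z) ≈⟨ x∧⟨x′∨y⟩≈x∧y ⟩
    x ∧ (x ′ ∨ ((x ∧ y) ∧ z)) ≈⟨ x∧⟨⟨x′∨y⟩∨z⟩≈x∧⟨y∨z⟩ ⟩
    x ∧ (x ′ ∨ (y ∧ z)) ≈⟨ x∧⟨x′∨y⟩≈x∧y ⟩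
    x ∧ (y ∧ z) ∎

  ∧-associative : E ⊢ ∧-associativity
  ∧-associative = Associativity.associative
    ⊢involution ⊢deMorgan ⊢absorption ⊢weak-commutativity ⊢∧-distributes-∨
    mem₂-diagonal x∧x≈x x∧⟨x∧y⟩≈x∧y x∧⟨x′∨y⟩≈x∧y ⟨x∧y⟩∧x≈x∧y x∧⟨⟨x∧y⟩∧z⟩≈x∧⟨y∧z⟩
    where
    mem₂-diagonal : E ⊢ (x ∨ y) ∧ y ≈ (x ∧ y) ∨ ((x ′ ∧ y) ∧ y)
    mem₂-diagonal =
      (x ∨ y) ∧ y ≈⟨ ⊢mem₂ ⟩
      (x ∧ y) ∨ ((x ′ ∧ y) ∧ y) ∎

-- Interderivability of each group with the axioms of CL.

module _ {K : Set} {E : List (Equation K)}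
  (⊢involution : E ⊢ involution) (⊢deMorgan : E ⊢ deMorgan)
  (⊢∧-associativity : E ⊢ ∧-associativity)
  where

  open Calculation ⊢involution ⊢deMorgan

  mem₁⇒mem₂ : E ⊢ mem₁ → E ⊢ mem₂
  mem₁⇒mem₂ ⊢mem₁ =
    (x ∨ y) ∧ z ≈⟨ ⊢mem₁ ⟩
    (x ∧ z) ∨ (x ′ ∧ (y ∧ z)) ≈⟨ ⊢∧-associativity ⟩
    (x ∧ z) ∨ ((x ′ ∧ y) ∧ z) ∎

  mem₂⇒mem₁ : E ⊢ mem₂ → E ⊢ mem₁
  mem₂⇒mem₁ ⊢mem₂ =
    (x ∨ y) ∧ z ≈⟨ ⊢mem₂ ⟩
    (x ∧ z) ∨ ((x ′ ∧ y) ∧ z) ≈⟨ ⊢∧-associativity ⟩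
    (x ∧ z) ∨ (x ′ ∧ (y ∧ z)) ∎

⊢-trans : ∀ {K} {E F : List (Equation K)} {e} → All (E ⊢_) F → F ⊢ e → E ⊢ e
⊢-trans E⊢F (axiom e∈F)        = All.lookup E⊢F e∈F
⊢-trans E⊢F reflexive          = reflexive
⊢-trans E⊢F (symmetric p)      = symmetric (⊢-trans E⊢F p)
⊢-trans E⊢F (transitive p q)   = transitive (⊢-trans E⊢F p) (⊢-trans E⊢F q)
⊢-trans E⊢F (′-congruence p)   = ′-congruence (⊢-trans E⊢F p)
⊢-trans E⊢F (∧-congruence p q) = ∧-congruence (⊢-trans E⊢F p) (⊢-trans E⊢F q)
⊢-trans E⊢F (∨-congruence p q) = ∨-congruence (⊢-trans E⊢F p) (⊢-trans E⊢F q)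
⊢-trans E⊢F (substitution σ p) = substitution σ (⊢-trans E⊢F p)

axioms : ∀ {K} {E : List (Equation K)} → All (E ⊢_) E
axioms = All.tabulate axiom

module _ {K : Set} where

  GroupI⊢CL : ∀ {E} → All (E ⊢_) (GroupI K) → All (E ⊢_) (CLAxioms K)
  GroupI⊢CL (i ∷ d ∷ m ∷ a ∷ c ∷ []) =
    i ∷ d ∷ ∧-associative ∷ ∧-distributive ∷ m ∷ a ∷ c ∷ []
    where open GroupIConsequences i d m a c

  GroupII⊢CL : ∀ {E} → All (E ⊢_) (GroupII K) → All (E ⊢_) (CLAxioms K)
  GroupII⊢CL (i ∷ d ∷ s ∷ m ∷ a ∷ c ∷ []) =
    i ∷ d ∷ ∧-associative ∷ s ∷ mem₂⇒mem₁ i d ∧-associative m ∷ a ∷ c ∷ []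
    where open GroupIIConsequences i d s m a c

  CL⊢GroupI : ∀ {E} → All (E ⊢_) (CLAxioms K) → All (E ⊢_) (GroupI K)
  CL⊢GroupI (i ∷ d ∷ _ ∷ _ ∷ m ∷ a ∷ c ∷ []) = i ∷ d ∷ m ∷ a ∷ c ∷ []

  CL⊢GroupII : ∀ {E} → All (E ⊢_) (CLAxioms K) → All (E ⊢_) (GroupII K)
  CL⊢GroupII (i ∷ d ∷ b ∷ s ∷ m ∷ a ∷ c ∷ []) =
    i ∷ d ∷ s ∷ mem₁⇒mem₂ i d b m ∷ a ∷ c ∷ []

-- Finite algebras and decidable separation.

record Algebra (K : Set) : Set where
  field
    size : ℕ
    neg : Vec (Fin size) size
    conj disj : Vec (Vec (Fin size) size) size
    const : K → Fin size

  Carrier : Set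
  Carrier = Fin size

  not : Carrier → Carrier
  not = Vec.lookup neg

  _and_ _or_ : Carrier → Carrier → Carrier
  a and b = Vec.lookup (Vec.lookup conj a) b
  a or b = Vec.lookup (Vec.lookup disj a) b

  ⟦_⟧ : Term K → (ℕ → Carrier) → Carrier
  ⟦ var i ⟧ ρ = ρ i
  ⟦ con c ⟧ ρ = const c
  ⟦ t ′ ⟧   ρ = not (⟦ t ⟧ ρ)
  ⟦ s ∧ t ⟧ ρ = (⟦ s ⟧ ρ) and (⟦ t ⟧ ρ)
  ⟦ s ∨ t ⟧ ρ = (⟦ s ⟧ ρ) or (⟦ t ⟧ ρ)

  Valid : Equation K → Set
  Valid (s ≈ t) = ∀ ρ → ⟦ s ⟧ ρ ≡ ⟦ t ⟧ ρ

  ⟦[]⟧ : ∀ t σ ρ → ⟦ t [ σ ] ⟧ ρ ≡ ⟦ t ⟧ (λ i → ⟦ σ i ⟧ ρ)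
  ⟦[]⟧ (var i) σ ρ = refl
  ⟦[]⟧ (con c) σ ρ = refl
  ⟦[]⟧ (t ′) σ ρ = cong not (⟦[]⟧ t σ ρ)
  ⟦[]⟧ (s ∧ t) σ ρ = cong₂ _and_ (⟦[]⟧ s σ ρ) (⟦[]⟧ t σ ρ)
  ⟦[]⟧ (s ∨ t) σ ρ = cong₂ _or_ (⟦[]⟧ s σ ρ) (⟦[]⟧ t σ ρ)

  sound : ∀ {E e} → All Valid E → E ⊢ e → Valid e
  sound v (axiom e∈E) ρ = All.lookup v e∈E ρ
  sound v reflexive ρ = refl
  sound v (symmetric p) ρ = sym (sound v p ρ)
  sound v (transitive p q) ρ = trans (sound v p ρ) (sound v q ρ)
  sound v (′-congruence p) ρ = cong not (sound v p ρ)
  sound v (∧-congruence p q) ρ = cong₂ _and_ (sound v p ρ) (sound v q ρ)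
  sound v (∨-congruence p q) ρ = cong₂ _or_ (sound v p ρ) (sound v q ρ)
  sound v (substitution {s} {t} σ p) ρ =
    trans (⟦[]⟧ s σ ρ) (trans (sound v p _) (sym (⟦[]⟧ t σ ρ)))

  values : Vec Carrier 3 → ℕ → Carrier
  values (a ∷ b ∷ c ∷ []) 0 = a
  values (a ∷ b ∷ c ∷ []) 1 = b
  values (a ∷ b ∷ c ∷ []) _ = c

  ternary : Term K → Bool
  ternary (var i) = i <ᵇ 3
  ternary (con c) = true
  ternary (t ′) = ternary t
  ternary (s ∧ t) = ternary s Bool.∧ ternary t
  ternary (s ∨ t) = ternary s Bool.∧ ternary t

  ⟦⟧-ternary : ∀ t → T (ternary t) → ∀ ρ →
               ⟦ t ⟧ ρ ≡ ⟦ t ⟧ (values (ρ 0 ∷ ρ 1 ∷ ρ 2 ∷ []))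
  ⟦⟧-ternary (var 0) _ ρ = refl
  ⟦⟧-ternary (var 1) _ ρ = refl
  ⟦⟧-ternary (var 2) _ ρ = refl
  ⟦⟧-ternary (con c) _ ρ = refl
  ⟦⟧-ternary (t ′) p ρ = cong not (⟦⟧-ternary t p ρ)
  ⟦⟧-ternary (s ∧ t) p ρ with p₁ , p₂ ← T-∧ .to p =
    cong₂ _and_ (⟦⟧-ternary s p₁ ρ) (⟦⟧-ternary t p₂ ρ)
  ⟦⟧-ternary (s ∨ t) p ρ with p₁ , p₂ ← T-∧ .to p =
    cong₂ _or_ (⟦⟧-ternary s p₁ ρ) (⟦⟧-ternary t p₂ ρ)

  Holds : Equation K → Set
  Holds (s ≈ t) = ∀ a b c → ⟦ s ⟧ (values (a ∷ b ∷ c ∷ [])) ≡ ⟦ t ⟧ (values (a ∷ b ∷ c ∷ []))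

  holds? : ∀ e → Dec (Holds e)
  holds? (s ≈ t) = all? λ a → all? λ b → all? λ c → _ Fin.≟ _

  -- `Valid` ranges over infinitely many valuations. An equation in the first three variables can be
  -- decided on triples, and the test `ternary` licenses the return to all valuations. Refuting an
  -- equation takes no such test.
  Satisfies : Equation K → Set
  Satisfies (s ≈ t) = T (ternary s Bool.∧ ternary t) × Holds (s ≈ t)

  satisfies? : ∀ e → Dec (Satisfies e)
  satisfies? (s ≈ t) = T? _ ×-dec holds? (s ≈ t)

  satisfies⇒valid : ∀ {e} → Satisfies e → Valid e
  satisfies⇒valid {s ≈ t} (p , h) ρ with p₁ , p₂ ← T-∧ .to p =
    trans (⟦⟧-ternary s p₁ ρ) (trans (h _ _ _) (sym (⟦⟧-ternary t p₂ ρ)))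

  Separates : List (Equation K) → Equation K → Set
  Separates E e = All Satisfies E × ¬ Holds e

  separates? : ∀ E e → Dec (Separates E e)
  separates? E e = All.all? satisfies? E ×-dec ¬? (holds? e)

  separates⇒⊬ : ∀ {E e} → Separates E e → ¬ (E ⊢ e)
  separates⇒⊬ (sat , fails) p =
    fails λ a b c → sound (All.map (λ {e} → satisfies⇒valid {e}) sat) p (values (a ∷ b ∷ c ∷ []))

open Algebra

-- `M` lists one countermodel per axiom, in the order of `E`.
independent : ∀ {K} {E : List (Equation K)} (M : Vec (Algebra K) (length E)) →
              {True (all? λ i → separates? (Vec.lookup M i) (removeAt E i) (lookup E i))} →
              Independent E
independent M {w} i = separates⇒⊬ (Vec.lookup M i) (toWitness w i)

deMorganAlgebra : ∀ {K} n (neg : Vec (Fin n) n) → Vec (Vec (Fin n) n) n → (K → Fin n) → Algebra K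
deMorganAlgebra n neg conj const = record
  { size = n ; neg = neg ; conj = conj ; const = const
  ; disj = tabulate λ i → tabulate λ j →
      Vec.lookup neg (Vec.lookup (Vec.lookup conj (Vec.lookup neg i)) (Vec.lookup neg j)) }

-- Passage to a smaller signature.

module _ {K L : Set} (f : K → L) where
  translate : Term K → Term L
  translate (var i) = var i
  translate (con c) = con (f c)
  translate (t ′) = translate t ′
  translate (s ∧ t) = translate s ∧ translate t
  translate (s ∨ t) = translate s ∨ translate t

  translateEquation : Equation K → Equation L
  translateEquation (s ≈ t) = translate s ≈ translate t

  translate-[] : ∀ t σ → translate (t [ σ ]) ≡ translate t [ translate ∘ σ ]
  translate-[] (var i) σ = refl
  translate-[] (con c) σ = refl
  translate-[] (t ′) σ = cong _′ (translate-[] t σ)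
  translate-[] (s ∧ t) σ = cong₂ _∧_ (translate-[] s σ) (translate-[] t σ)
  translate-[] (s ∨ t) σ = cong₂ _∨_ (translate-[] s σ) (translate-[] t σ)

  translate-⊢ : ∀ {E F e} → map translateEquation E ⊆ F → E ⊢ e → F ⊢ translateEquation e
  translate-⊢ E⊆F (axiom e∈E) = axiom (to∈ (⊆-trans (from∈ (∈-map⁺ translateEquation e∈E)) E⊆F))
  translate-⊢ E⊆F reflexive = reflexive
  translate-⊢ E⊆F (symmetric p) = symmetric (translate-⊢ E⊆F p)
  translate-⊢ E⊆F (transitive p q) = transitive (translate-⊢ E⊆F p) (translate-⊢ E⊆F q)
  translate-⊢ E⊆F (′-congruence p) = ′-congruence (translate-⊢ E⊆F p)
  translate-⊢ E⊆F (∧-congruence p q) = ∧-congruence (translate-⊢ E⊆F p) (translate-⊢ E⊆F q)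
  translate-⊢ E⊆F (∨-congruence p q) = ∨-congruence (translate-⊢ E⊆F p) (translate-⊢ E⊆F q)
  translate-⊢ E⊆F (substitution {s} {t} σ p)
    rewrite translate-[] s σ | translate-[] t σ = substitution _ (translate-⊢ E⊆F p)

  -- Order-preserving inclusion lets a position of `E` determine one of `F`, so that deleting the
  -- axiom on both sides keeps the inclusion.
  remove-⊆ : ∀ {E F} → map translateEquation E ⊆ F → (i : Fin (length E)) →
             ∃ λ j → lookup F j ≡ translateEquation (lookup E i) ×
                     map translateEquation (removeAt E i) ⊆ removeAt F j
  remove-⊆ {e ∷ E} (_ ∷ʳ τ) i with j , eq , τ′ ← remove-⊆ {e ∷ E} τ i = suc j , eq , _ ∷ʳ τ′
  remove-⊆ {_ ∷ _} (refl ∷ τ) zero    = zero , refl , τ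
  remove-⊆ {_ ∷ _} (refl ∷ τ) (suc i) with j , eq , τ′ ← remove-⊆ τ i = suc j , eq , refl ∷ τ′

  independent-reduct : ∀ {E F} → map translateEquation E ⊆ F → Independent F → Independent E
  independent-reduct {E} {F} τ ind i p with j , eq , τ′ ← remove-⊆ τ i =
    ind j (subst (removeAt F j ⊢_) (sym eq) (translate-⊢ τ′ p))

-- The countermodels.

TFU→ : ∀ {A : Set} → A → A → A → TFU → A
TFU→ t f u 𝖳 = t
TFU→ t f u 𝖥 = f
TFU→ t f u 𝖴 = u

-- In the algebras with at least three elements, 0, 1 and 2 play T, F and U (C may name them
-- otherwise).  In nonCommuting a second fixed point of ′ is left zero for ∧; nonDistributive
-- was found by computer search.

nonInvolutive nonDeMorgan nonAbsorbing nonMem nonCommuting nonDistributive : Algebra TFU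

-- Conjunction is addition modulo 2 and disjunction the first projection, so both sides of either
-- memory axiom are `x + z`. De Morgan then asks for `(x + y)′ = x′`, that is, for a constant `′`;
-- the identity as `′` keeps involution instead.
nonInvolutive = record
  { size = 2 ; neg = # 0 ∷ # 0 ∷ []
  ; conj = (# 0 ∷ # 1 ∷ []) ∷ (# 1 ∷ # 0 ∷ []) ∷ []
  ; disj = (# 0 ∷ # 0 ∷ []) ∷ (# 1 ∷ # 1 ∷ []) ∷ []
  ; const = λ _ → # 0 }

nonDeMorgan = record nonInvolutive { neg = # 0 ∷ # 1 ∷ [] }

nonAbsorbing = record
  { size = 2 ; neg = # 0 ∷ # 1 ∷ [] ; conj = or ; disj = or ; const = λ _ → # 0 }
  where
  or = (# 0 ∷ # 1 ∷ []) ∷ (# 1 ∷ # 1 ∷ []) ∷ []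

-- Kleene's strong three-valued logic: with `x = U` and `y = z = T`, the left side of either memory
-- axiom is T and the right side U.
nonMem = deMorganAlgebra 3 (# 1 ∷ # 0 ∷ # 2 ∷ [])
  ( (# 0 ∷ # 1 ∷ # 2 ∷ [])
  ∷ (# 1 ∷ # 1 ∷ # 1 ∷ [])
  ∷ (# 2 ∷ # 1 ∷ # 2 ∷ []) ∷ [])
  (TFU→ (# 0) (# 1) (# 2))

-- The equations without constants hold in C however the constants are named. Naming T by `𝖴`, or U
-- by all three constants, or U by both `𝖥` and `𝖴`, breaks exactly `U-fixed`, `T-identity` or
-- `T-negation` respectively.
C : Fin 3 → Fin 3 → Fin 3 → Algebra TFU
C t f u = deMorganAlgebra 3 (# 1 ∷ # 0 ∷ # 2 ∷ [])
  ( (# 0 ∷ # 1 ∷ # 2 ∷ [])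
  ∷ (# 1 ∷ # 1 ∷ # 1 ∷ [])
  ∷ (# 2 ∷ # 2 ∷ # 2 ∷ []) ∷ [])
  (TFU→ t f u)

nonCommuting = deMorganAlgebra 4 (# 1 ∷ # 0 ∷ # 2 ∷ # 3 ∷ [])
  ( allFin 4 ∷ replicate 4 (# 1) ∷ replicate 4 (# 2) ∷ replicate 4 (# 3) ∷ [])
  (TFU→ (# 0) (# 1) (# 2))

-- Distributivity fails at 8, 3, 5: `8 ∧ (3 ∨ 5) = 8 ∧ 2 = 2`, whereas
-- `(8 ∧ 3) ∨ (8 ∧ 5) = 7 ∨ 7 = 7`.
nonDistributive = deMorganAlgebra 9
  (# 1 ∷ # 0 ∷ # 2 ∷ # 4 ∷ # 3 ∷ # 6 ∷ # 5 ∷ # 8 ∷ # 7 ∷ [])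
  ( allFin 9
  ∷ replicate 9 (# 1)
  ∷ replicate 9 (# 2)
  ∷ replicate 9 (# 3)
  ∷ (# 4 ∷ # 3 ∷ # 2 ∷ # 3 ∷ # 4 ∷ # 2 ∷ # 2 ∷ # 7 ∷ # 8 ∷ [])
  ∷ replicate 9 (# 5)
  ∷ (# 6 ∷ # 5 ∷ # 2 ∷ # 2 ∷ # 2 ∷ # 5 ∷ # 6 ∷ # 7 ∷ # 8 ∷ [])
  ∷ replicate 9 (# 7)
  ∷ (# 8 ∷ # 7 ∷ # 2 ∷ # 7 ∷ # 8 ∷ # 7 ∷ # 8 ∷ # 7 ∷ # 8 ∷ [])
  ∷ [])
  (TFU→ (# 0) (# 1) (# 2))

independent-I : Independent (U-fixed 𝖴 ∷ T-identity 𝖳 ∷ T-negation 𝖳 𝖥 ∷ GroupI TFU)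
independent-I = independent
  ( C (# 0) (# 1) (# 0) ∷ C (# 2) (# 2) (# 2) ∷ C (# 0) (# 2) (# 2)
  ∷ nonInvolutive ∷ nonDeMorgan ∷ nonMem ∷ nonAbsorbing ∷ nonCommuting ∷ [])

independent-II : Independent (U-fixed 𝖴 ∷ T-identity 𝖳 ∷ T-negation 𝖳 𝖥 ∷ GroupII TFU)
independent-II = independent
  ( C (# 0) (# 1) (# 0) ∷ C (# 2) (# 2) (# 2) ∷ C (# 0) (# 2) (# 2)
  ∷ nonInvolutive ∷ nonDeMorgan ∷ nonDistributive ∷ nonMem ∷ nonAbsorbing ∷ nonCommuting ∷ [])

-- Completeness and independence for the four signatures.

completelyAxiomatises : ∀ {K} {C D E : List (Equation K)} → C ↭ D →
  (∀ {A} → All (A ⊢_) (CLAxioms K) → All (A ⊢_) E) →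
  (∀ {A} → All (A ⊢_) E → All (A ⊢_) (CLAxioms K)) →
  CompletelyAxiomatises (C ++ E) (CLAxioms K ++ D)
completelyAxiomatises {K} {C} C↭D CL⊢E E⊢CL e = mk⇔
  (⊢-trans (++⁺ (All-resp-↭ (↭-sym C↭D) (++⁻ʳ (CLAxioms K) axioms))
                (CL⊢E (++⁻ˡ (CLAxioms K) axioms))))
  (⊢-trans (++⁺ (E⊢CL (++⁻ʳ C axioms)) (All-resp-↭ C↭D (++⁻ˡ C axioms))))

by-I : ∀ {K} {C D : List (Equation K)} → C ↭ D →
       CompletelyAxiomatises (C ++ GroupI K) (CLAxioms K ++ D)
by-I C↭D = completelyAxiomatises C↭D CL⊢GroupI GroupI⊢CL

by-II : ∀ {K} {C D : List (Equation K)} → C ↭ D →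
        CompletelyAxiomatises (C ++ GroupII K) (CLAxioms K ++ D)
by-II C↭D = completelyAxiomatises C↭D CL⊢GroupII GroupII⊢CL

fromTF : TF → TFU
fromTF 𝖳 = 𝖳
fromTF 𝖥 = 𝖥

fromU : U → TFU
fromU 𝖴 = 𝖴

theorem5p1 : IndependentAxiomatisation (GroupI ⊥) CL
    × IndependentAxiomatisation (GroupII ⊥) CL
    × ( IndependentAxiomatisation (T-identity 𝖳 ∷ T-negation 𝖳 𝖥 ∷ GroupI TF) CL₂
    × IndependentAxiomatisation (T-identity 𝖳 ∷ T-negation 𝖳 𝖥 ∷ GroupII TF) CL₂ )
    × ( IndependentAxiomatisation (U-fixed 𝖴 ∷ GroupI U) CLᵁ
    × IndependentAxiomatisation (U-fixed 𝖴 ∷ GroupII U) CLᵁ )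
    × ( IndependentAxiomatisation (U-fixed 𝖴 ∷ T-identity 𝖳 ∷ T-negation 𝖳 𝖥 ∷ GroupI TFU) CL₃
    × IndependentAxiomatisation (U-fixed 𝖴 ∷ T-identity 𝖳 ∷ T-negation 𝖳 𝖥 ∷ GroupII TFU) CL₃ )
theorem5p1 =
    (by-I {C = []} ↭-refl , independent-reduct (λ ()) (_ ∷ʳ _ ∷ʳ _ ∷ʳ ⊆-refl) independent-I)
  , (by-II {C = []} ↭-refl , independent-reduct (λ ()) (_ ∷ʳ _ ∷ʳ _ ∷ʳ ⊆-refl) independent-II)
  , ( (by-I {C = T-identity 𝖳 ∷ T-negation 𝖳 𝖥 ∷ []} ↭-refl
        , independent-reduct fromTF (_ ∷ʳ ⊆-refl) independent-I)
    , (by-II {C = T-identity 𝖳 ∷ T-negation 𝖳 𝖥 ∷ []} ↭-refl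
        , independent-reduct fromTF (_ ∷ʳ ⊆-refl) independent-II) )
  , ( (by-I {C = U-fixed 𝖴 ∷ []} ↭-refl
        , independent-reduct fromU (refl ∷ _ ∷ʳ _ ∷ʳ ⊆-refl) independent-I)
    , (by-II {C = U-fixed 𝖴 ∷ []} ↭-refl
        , independent-reduct fromU (refl ∷ _ ∷ʳ _ ∷ʳ ⊆-refl) independent-II) )
  , ( (by-I U-last , independent-I) , (by-II U-last , independent-II) )
  where
  U-last : U-fixed 𝖴 ∷ T-identity 𝖳 ∷ T-negation 𝖳 𝖥 ∷ [] ↭
           T-identity 𝖳 ∷ T-negation 𝖳 𝖥 ∷ U-fixed 𝖴 ∷ []
  U-last = ↭-sym (shift (U-fixed 𝖴) (T-identity 𝖳 ∷ T-negation 𝖳 𝖥 ∷ []) [])
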